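{- For every integer $\Delta\geq 5$ and every integer $k$, there exists a $\Delta$-regular graph with slope-number greater than $k$. (That is, for all $\Delta\ge 5$ there exist $\Delta$-regular graphs with arbitrarily large slope-number.)
   Context: Graphs are undirected, finite and simple. A geometric drawing of a graph represents each vertex by a distinct point in the plane $\mathbb{R}^2$ and each edge by the straight line segment between its endpoints, such that the only vertices an edge intersects are its own endpoints. The slope-number of a graph $G$ is the minimum number of distinct edge slopes in a geometric drawing of $G$ (slopes lie in $\mathbb{R}\cup\{\infty\}$). -}

module Defs where

open import Data.Fin.Base using (Fin)
open import Data.List.Base using (length; filter; allFin)
open import Data.Maybe.Base using (Maybe; just; nothing)
open import Data.Maybe.Relation.Binary.Pointwise using (Pointwise)
open import Data.Nat.Base as ℕ using (ℕ)
import Data.Nat.Properties as ℕ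
open import Data.Product.Base using (Σ; ∃; ∃₂; _×_; _,_)
open import Data.Rational.Base as ℚ using (ℚ; 0ℚ; 1ℚ; ½; Positive)
import Data.Rational.Properties as ℚ
open import Data.Rational.Solver using (module +-*-Solver)
open import Data.Sum.Base using (_⊎_)
open import Function.Definitions using (Injective)
open import Level using (0ℓ)
open import Relation.Binary.Core using (Rel)
open import Relation.Binary.Definitions using (Decidable; Irreflexive; Symmetric)
open import Relation.Binary.PropositionalEquality
  using (_≡_; refl; sym; trans; cong; subst)
open import Relation.Nullary.Negation.Core using (¬_)

------------------------------------------------------------------------
-- Real numbers: Cauchy sequences of rationals with termwise operations,
-- compared by the setoid equality _≃_ (the difference is a null
-- sequence) rather than by _≡_.

EventuallyForAll : (ℕ → Set) → Set
EventuallyForAll P = ∃ λ N → ∀ n → N ℕ.≤ n → P n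

record ℝ : Set where
  constructor mkℝ
  field
    seq    : ℕ → ℚ
    cauchy : ∀ ε → 0ℚ ℚ.< ε →
             ∃ λ N → ∀ m n → N ℕ.≤ m → N ℕ.≤ n → ℚ.∣ seq m ℚ.- seq n ∣ ℚ.< ε

open ℝ public

infix 4 _≃_ _≤_

_≃_ : Rel ℝ 0ℓ
x ≃ y = ∀ ε → 0ℚ ℚ.< ε →
        EventuallyForAll λ n → ℚ.∣ seq x n ℚ.- seq y n ∣ ℚ.< ε

_≤_ : Rel ℝ 0ℓ
x ≤ y = ∀ ε → 0ℚ ℚ.< ε →
        EventuallyForAll λ n → seq x n ℚ.< seq y n ℚ.+ ε

fromℚ : ℚ → ℝ
fromℚ q = mkℝ (λ _ → q) λ ε 0<ε →
  0 , λ _ _ _ _ → subst (ℚ._< ε) (sym (cong ℚ.∣_∣ (ℚ.+-inverseʳ q))) 0<ε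

0ℝ 1ℝ : ℝ
0ℝ = fromℚ 0ℚ
1ℝ = fromℚ 1ℚ

half>0 : ∀ {ε} → 0ℚ ℚ.< ε → 0ℚ ℚ.< ½ ℚ.* ε
half>0 {ε} 0<ε = subst (ℚ._< ½ ℚ.* ε) (ℚ.*-zeroʳ ½) (ℚ.*-monoʳ-<-pos ½ 0<ε)

half+half : ∀ ε → ½ ℚ.* ε ℚ.+ ½ ℚ.* ε ≡ ε
half+half ε = trans (sym (ℚ.*-distribʳ-+ ε ½ ½)) (ℚ.*-identityˡ ε)

sum<ε : ∀ {p q r s ε} → p ℚ.≤ r ℚ.+ s → q ≡ p →
        r ℚ.< ½ ℚ.* ε → s ℚ.< ½ ℚ.* ε → q ℚ.< ε
sum<ε {ε = ε} p≤r+s refl r< s< = ℚ.≤-<-trans p≤r+s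
  (subst (_ ℚ.<_) (half+half ε) (ℚ.+-mono-< r< s<))

eventually-bounded : (x : ℝ) →
  ∃ λ B → Positive B × EventuallyForAll λ n → ℚ.∣ seq x n ∣ ℚ.< B
eventually-bounded x with cauchy x 1ℚ (ℚ.positive⁻¹ 1ℚ)
... | N , close = B , ℚ.positive 0<B , N , bound
  where
  B : ℚ
  B = 1ℚ ℚ.+ ℚ.∣ seq x N ∣
  0<B : 0ℚ ℚ.< B
  0<B = ℚ.+-mono-<-≤ (ℚ.positive⁻¹ 1ℚ) (ℚ.0≤∣p∣ (seq x N))
  split : ∀ a b → (a ℚ.- b) ℚ.+ b ≡ a
  split = solve 2 (λ a b → (a :- b) :+ b := a) refl
    where open +-*-Solver
  bound : ∀ n → N ℕ.≤ n → ℚ.∣ seq x n ∣ ℚ.< B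
  bound n N≤n = begin-strict
    ℚ.∣ a ∣                     ≡⟨ cong ℚ.∣_∣ (split a b) ⟨
    ℚ.∣ (a ℚ.- b) ℚ.+ b ∣       ≤⟨ ℚ.∣p+q∣≤∣p∣+∣q∣ (a ℚ.- b) b ⟩
    ℚ.∣ a ℚ.- b ∣ ℚ.+ ℚ.∣ b ∣   <⟨ ℚ.+-monoˡ-< ℚ.∣ b ∣ (close n N N≤n ℕ.≤-refl) ⟩
    B                           ∎
    where
    open ℚ.≤-Reasoning
    a = seq x n
    b = seq x N

rescale : ∀ B → Positive B → ∀ {ε} → 0ℚ ℚ.< ε →
          ∃ λ δ → 0ℚ ℚ.< δ × B ℚ.* δ ≡ ε
rescale B B>0 {ε} 0<ε = 1/B ℚ.* ε , 0<δ , eq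
  where
  instance
    _ = B>0
    _ = ℚ.pos⇒nonZero B
    _ = ℚ.1/pos⇒pos B
  1/B : ℚ
  1/B = ℚ.1/ B
  0<δ : 0ℚ ℚ.< 1/B ℚ.* ε
  0<δ = subst (ℚ._< 1/B ℚ.* ε) (ℚ.*-zeroʳ 1/B) (ℚ.*-monoʳ-<-pos 1/B 0<ε)
  eq : B ℚ.* (1/B ℚ.* ε) ≡ ε
  eq = trans (sym (ℚ.*-assoc B 1/B ε))
      (trans (cong (ℚ._* ε) (ℚ.*-inverseʳ B)) (ℚ.*-identityˡ ε))

product-bound : ∀ {a b B δ ε} → Positive B → ℚ.∣ a ∣ ℚ.< B → ℚ.∣ b ∣ ℚ.< δ →
                B ℚ.* δ ≡ ε → ℚ.∣ a ℚ.* b ∣ ℚ.< ε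
product-bound {a} {b} {B} {δ} B>0 a< b< refl = begin-strict
  ℚ.∣ a ℚ.* b ∣          ≡⟨ ℚ.∣p*q∣≡∣p∣*∣q∣ a b ⟩
  ℚ.∣ a ∣ ℚ.* ℚ.∣ b ∣    ≤⟨ ℚ.*-monoʳ-≤-nonNeg ℚ.∣ b ∣ (ℚ.<⇒≤ a<) ⟩
  B ℚ.* ℚ.∣ b ∣          <⟨ ℚ.*-monoʳ-<-pos B b< ⟩
  B ℚ.* δ                ∎
  where
  open ℚ.≤-Reasoning
  instance
    _ = B>0
    _ = ℚ.∣-∣-nonNeg b

infixl 6 _+_ _-_
infixl 7 _*_
infix  8 -_

_+_ : ℝ → ℝ → ℝ
x + y = mkℝ (λ n → seq x n ℚ.+ seq y n) λ ε 0<ε →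
  let (M , closeˣ) = cauchy x (½ ℚ.* ε) (half>0 0<ε)
      (N , closeʸ) = cauchy y (½ ℚ.* ε) (half>0 0<ε)
  in M ℕ.⊔ N , λ m n ≤m ≤n → sum<ε
       (ℚ.∣p+q∣≤∣p∣+∣q∣ (seq x m ℚ.- seq x n) (seq y m ℚ.- seq y n))
       (cong ℚ.∣_∣ (regroup (seq x m) (seq y m) (seq x n) (seq y n)))
       (closeˣ m n (ℕ.m⊔n≤o⇒m≤o M N ≤m) (ℕ.m⊔n≤o⇒m≤o M N ≤n))
       (closeʸ m n (ℕ.m⊔n≤o⇒n≤o M N ≤m) (ℕ.m⊔n≤o⇒n≤o M N ≤n))
  where
  regroup : ∀ a b c d → (a ℚ.+ b) ℚ.- (c ℚ.+ d) ≡ (a ℚ.- c) ℚ.+ (b ℚ.- d)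
  regroup = solve 4 (λ a b c d → (a :+ b) :- (c :+ d) := (a :- c) :+ (b :- d)) refl
    where open +-*-Solver

-_ : ℝ → ℝ
- x = mkℝ (λ n → ℚ.- seq x n) λ ε 0<ε →
  let (N , close) = cauchy x ε 0<ε
  in N , λ m n ≤m ≤n → subst (ℚ._< ε)
       (trans (sym (ℚ.∣-p∣≡∣p∣ (seq x m ℚ.- seq x n)))
              (cong ℚ.∣_∣ (ℚ.neg-distrib-+ (seq x m) (ℚ.- seq x n))))
       (close m n ≤m ≤n)

_-_ : ℝ → ℝ → ℝ
x - y = x + (- y)

_*_ : ℝ → ℝ → ℝ
x * y = mkℝ (λ n → seq x n ℚ.* seq y n) λ ε 0<ε →
  let (A , A>0 , K , boundˣ) = eventually-bounded x
      (B , B>0 , L , boundʸ) = eventually-bounded y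
      (δ , 0<δ , A*δ≡)       = rescale A A>0 (half>0 0<ε)
      (η , 0<η , B*η≡)       = rescale B B>0 (half>0 0<ε)
      (M , closeʸ)           = cauchy y δ 0<δ
      (N , closeˣ)           = cauchy x η 0<η
      KM = K ℕ.⊔ M
      LN = L ℕ.⊔ N
  in KM ℕ.⊔ LN , λ m n ≤m ≤n →
       let KM≤m = ℕ.m⊔n≤o⇒m≤o KM LN ≤m
           KM≤n = ℕ.m⊔n≤o⇒m≤o KM LN ≤n
           LN≤m = ℕ.m⊔n≤o⇒n≤o KM LN ≤m
           LN≤n = ℕ.m⊔n≤o⇒n≤o KM LN ≤n
       in sum<ε
         (ℚ.∣p+q∣≤∣p∣+∣q∣ (seq x m ℚ.* (seq y m ℚ.- seq y n))
                          (seq y n ℚ.* (seq x m ℚ.- seq x n)))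
         (cong ℚ.∣_∣ (regroup (seq x m) (seq y m) (seq x n) (seq y n)))
         (product-bound {seq x m} {seq y m ℚ.- seq y n} A>0
           (boundˣ m (ℕ.m⊔n≤o⇒m≤o K M KM≤m))
           (closeʸ m n (ℕ.m⊔n≤o⇒n≤o K M KM≤m) (ℕ.m⊔n≤o⇒n≤o K M KM≤n)) A*δ≡)
         (product-bound {seq y n} {seq x m ℚ.- seq x n} B>0
           (boundʸ n (ℕ.m⊔n≤o⇒m≤o L N LN≤n))
           (closeˣ m n (ℕ.m⊔n≤o⇒n≤o L N LN≤m) (ℕ.m⊔n≤o⇒n≤o L N LN≤n)) B*η≡)
  where
  regroup : ∀ a b c d →
            a ℚ.* b ℚ.- c ℚ.* d ≡ a ℚ.* (b ℚ.- d) ℚ.+ d ℚ.* (a ℚ.- c)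
  regroup = solve 4 (λ a b c d →
    a :* b :- c :* d := a :* (b :- d) :+ d :* (a :- c)) refl
    where open +-*-Solver

------------------------------------------------------------------------
-- The plane

Point : Set
Point = ℝ × ℝ

infix 4 _≈ₚ_

_≈ₚ_ : Rel Point 0ℓ
(x₁ , y₁) ≈ₚ (x₂ , y₂) = (x₁ ≃ x₂) × (y₁ ≃ y₂)

-- OnSegment p q r: the point r lies on the closed segment from p to q.
OnSegment : Point → Point → Point → Set
OnSegment (px , py) (qx , qy) r = ∃ λ t →
  (0ℝ ≤ t) × (t ≤ 1ℝ) × (r ≈ₚ (px + t * (qx - px) , py + t * (qy - py)))

-- Elements of ℝ ∪ {∞}, with nothing standing for ∞.
Slope : Set
Slope = Maybe ℝ

infix 4 _≈ₛ_

_≈ₛ_ : Rel Slope 0ℓ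
_≈ₛ_ = Pointwise _≃_

-- Being vertical is undecidable for these reals, so the slope of the
-- segment between two distinct points is given as a relation.
HasSlope : Point → Point → Slope → Set
HasSlope (px , py) (qx , qy) nothing  = px ≃ qx
HasSlope (px , py) (qx , qy) (just m) = ¬ (px ≃ qx) × (qy - py ≃ m * (qx - px))

------------------------------------------------------------------------
-- Finite simple graphs

record Graph : Set₁ where
  infix 4 _~_ _~?_
  field
    order    : ℕ
    _~_      : Rel (Fin order) 0ℓ
    _~?_     : Decidable _~_
    ~-sym    : Symmetric _~_
    ~-irrefl : Irreflexive _≡_ _~_

  Vertex : Set
  Vertex = Fin order

  degree : Vertex → ℕ
  degree v = length (filter (v ~?_) (allFin order))

Regular : ℕ → Graph → Set
Regular Δ G = ∀ v → degree v ≡ Δ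
  where open Graph G

------------------------------------------------------------------------
-- Geometric drawings and the slope-number

module _ (G : Graph) where
  open Graph G

  record GeometricDrawing : Set where
    field
      pos          : Vertex → Point
      pos-distinct : Injective _≡_ _≈ₚ_ pos
      edge-avoids  : ∀ {u v w} → u ~ v → OnSegment (pos u) (pos v) (pos w) →
                     w ≡ u ⊎ w ≡ v

  -- The set of slopes of edges in the drawing has exactly s elements,
  -- enumerated without repetition by σ.
  HasSlopeCount : GeometricDrawing → ℕ → Set
  HasSlopeCount D s = Σ (Fin s → Slope) λ σ →
      Injective _≡_ _≈ₛ_ σ
    × (∀ i → ∃₂ λ u v → u ~ v × HasSlope (pos u) (pos v) (σ i))
    × (∀ {u v} → u ~ v → ∃ λ i → HasSlope (pos u) (pos v) (σ i))
    where open GeometricDrawing D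

  -- Classically there is always a unique such s.  Constructively only the
  -- double negation of its existence is available, since the minimum is
  -- taken over an undecidable predicate.
  IsSlopeNumber : ℕ → Set
  IsSlopeNumber s =
      (∃ λ D → HasSlopeCount D s)
    × (∀ D t → HasSlopeCount D t → s ℕ.≤ t)

{-# OPTIONS --safe #-}
module Submission where

-- After Pach and Pálvölgyi.  A square of a path together with a matching between its two halves has
-- maximum degree 5.  In a drawing, every three consecutive vertices of the path form a nondegenerate
-- triangle, so the directions of the path edges determine the drawing up to translation and scaling;
-- the direction of the matching edge at a vertex then determines its partner, since otherwise one of
-- two candidate partners would lie on the edge to the other.  Hence only exponentially many of the n!
-- matchings can be drawn with k slopes, and for large n the disjoint union of all these graphs has
-- slope-number greater than k.  So has any Δ-regular graph containing it.

-- A slope fixes the direction of an edge only up to sign, and two candidate partners on opposite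
-- sides of a vertex do not obstruct each other. Labels therefore pair a slope with a sign, which
-- gives `K = 2 (k + 1)` of them. With five kinds of link at each of `2 n` vertices there are
-- `(K ^ 5) ^ (2 n)` tables of labels, exponential in `n`.
--
-- The slopes of a drawing are arbitrary reals, so separate drawings of different graphs would have
-- no finite set of labels in common. Drawing all matchings at once, as a disjoint union, makes them
-- share one list of slopes, and the pigeonhole principle applies to their tables.
--
-- The path is squared so that three consecutive vertices are pairwise adjacent: on a common line,
-- one of them would lie on the edge joining the other two.
--
-- Signs of Cauchy reals are undecidable, so case distinctions on signs and the choice of labels
-- live under double negation. This is harmless: `≈` is stable, equality of partners is decidable,
-- and the counting argument ends in a contradiction.

open import Algebra.Bundles using (CommutativeRing)
import Algebra.Properties.Group as GroupProperties
import Algebra.Solver.Ring as RingSolver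
open import Algebra.Solver.Ring.AlmostCommutativeRing
  using (_-Raw-AlmostCommutative⟶_; fromCommutativeRing)
open import Algebra.Structures using (IsCommutativeRing)
open import Data.Bool.Base using (true; false)
open import Data.Empty using (⊥)
open import Data.Fin.Base as Fin
  using (Fin; zero; suc; toℕ; fromℕ<; inject≤; funToFin; finToFun; punchIn; remQuot; combine; splitAt; _↑ˡ_; _↑ʳ_)
open import Data.Fin.Patterns using (0F; 1F; 2F; 3F; 4F)
import Data.Fin.Properties as Fin
open import Data.Integer.Base as ℤ using (ℤ; +_; -[1+_]; _<_)
open import Data.List.Base
  using (List; _∷_; _++_; length; lookup; filter; allFin; tabulate; upTo)
open import Data.List.Membership.Propositional using (_∈_)
open import Data.List.Membership.Propositional.Properties
  using (∈-allFin; ∈-lookup; ∈-length; ∈-filter⁺; ∈-upTo⁺)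
import Data.List.Properties as List
import Data.List.Relation.Unary.All as All
open import Data.List.Relation.Unary.All.Properties using (all-filter)
open import Data.List.Relation.Unary.AllPairs using (_∷_)
open import Data.List.Relation.Unary.Any using (index)
open import Data.List.Relation.Unary.Any.Properties using (lookup-index)
open import Data.List.Relation.Unary.Unique.Propositional using (Unique)
open import Data.List.Relation.Unary.Unique.Propositional.Properties using (allFin⁺; filter⁺; upTo⁺)
open import Data.Maybe.Base as Maybe using (Maybe; just; nothing)
open import Data.Maybe.Relation.Binary.Pointwise using (just)
open import Data.Nat.Base as ℕ using (ℕ; zero; suc; _!; _^_; _≤_)
import Data.Nat.Properties as ℕ
open import Data.Product.Base using (∃; ∃₂; _×_; _,_; proj₁; proj₂; uncurry)
open import Data.Rational.Base as ℚ using (ℚ; 0ℚ; 1ℚ; ½)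
import Data.Rational.Properties as ℚ
open import Data.Rational.Solver using (module +-*-Solver)
open import Data.Sum.Base as Sum using (_⊎_; inj₁; inj₂; [_,_]′)
open import Function.Base using (_∘_; _$_; id)
open import Level using (0ℓ)
open import Relation.Binary.Definitions using (Decidable)
import Relation.Binary.Reasoning.Setoid as SetoidReasoning
open import Relation.Binary.PropositionalEquality
  using (_≡_; refl; sym; trans; cong; cong₂; subst; subst₂; module ≡-Reasoning)
open import Relation.Binary.Structures using (IsEquivalence)
open import Relation.Nullary.Decidable
  using (Dec; yes; no; does; _×-dec_; dec⇒maybe; decidable-stable)
open import Relation.Nullary.Negation.Core using (¬_; contradiction)
open import Relation.Unary as U using (Pred)

open import Defs
  renaming (_+_ to _+ᴿ_; _*_ to _*ᴿ_; -_ to -ᴿ_; _-_ to _-ᴿ_; _≤_ to _≤ᴿ_)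

-- Real numbers

module ℚ-Group = GroupProperties ℚ.+-0-group

p≤∣p∣ : ∀ p → p ℚ.≤ ℚ.∣ p ∣
p≤∣p∣ p with ℚ.≤-total 0ℚ p
... | inj₁ 0≤p = ℚ.≤-reflexive (sym (ℚ.0≤p⇒∣p∣≡p 0≤p))
... | inj₂ p≤0 = ℚ.≤-trans p≤0 (ℚ.0≤∣p∣ p)

∣p-q∣≡∣q-p∣ : ∀ p q → ℚ.∣ p ℚ.- q ∣ ≡ ℚ.∣ q ℚ.- p ∣
∣p-q∣≡∣q-p∣ p q = trans (sym (ℚ.∣-p∣≡∣p∣ (p ℚ.- q)))
  (cong ℚ.∣_∣ (solve 2 (λ p q → :- (p :- q) := q :- p) refl p q))
  where open +-*-Solver

∣p-q∣<r⇒p<q+r : ∀ {p q r} → ℚ.∣ p ℚ.- q ∣ ℚ.< r → p ℚ.< q ℚ.+ r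
∣p-q∣<r⇒p<q+r {p} {q} {r} ∣p-q∣<r = begin-strict
  p                    ≡⟨ solve 2 (λ p q → p := q :+ (p :- q)) refl p q ⟩
  q ℚ.+ (p ℚ.- q)      ≤⟨ ℚ.+-monoʳ-≤ q (p≤∣p∣ (p ℚ.- q)) ⟩
  q ℚ.+ ℚ.∣ p ℚ.- q ∣  <⟨ ℚ.+-monoʳ-< q ∣p-q∣<r ⟩
  q ℚ.+ r              ∎
  where open ℚ.≤-Reasoning
        open +-*-Solver

r+s≤p⇒r≤q : ∀ {p q r s} → r ℚ.+ s ℚ.≤ p → ℚ.∣ p ℚ.- q ∣ ℚ.< s → r ℚ.≤ q
r+s≤p⇒r≤q {p} {q} {r} {s} r+s≤p ∣p-q∣<s = begin
  r                      ≡⟨ solve 2 (λ r s → r := (r :+ s) :- s) refl r s ⟩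
  (r ℚ.+ s) ℚ.- s        ≤⟨ ℚ.+-monoˡ-≤ (ℚ.- s) (ℚ.≤-trans r+s≤p (ℚ.<⇒≤ (∣p-q∣<r⇒p<q+r {p} {q} ∣p-q∣<s))) ⟩
  (q ℚ.+ s) ℚ.- s        ≡⟨ solve 2 (λ r s → (r :+ s) :- s := r) refl q s ⟩
  q                      ∎
  where open ℚ.≤-Reasoning
        open +-*-Solver

eventually-× : ∀ {P Q} → EventuallyForAll P → EventuallyForAll Q →
               EventuallyForAll λ n → P n × Q n
eventually-× (M , p) (N , q) = M ℕ.⊔ N , λ n ≤n →
  p n (ℕ.m⊔n≤o⇒m≤o M N ≤n) , q n (ℕ.m⊔n≤o⇒n≤o M N ≤n)

eventually-map : ∀ {P Q : ℕ → Set} → (∀ n → P n → Q n) → EventuallyForAll P → EventuallyForAll Q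
eventually-map f (M , p) = M , λ n ≤n → f n (p n ≤n)

≗⇒≃ : ∀ {x y} → (∀ n → seq x n ≡ seq y n) → x ≃ y
≗⇒≃ {x} {y} x≗y ε 0<ε = 0 , λ n _ → subst (ℚ._< ε)
  (sym (trans (cong (λ p → ℚ.∣ p ℚ.- seq y n ∣) (x≗y n)) (cong ℚ.∣_∣ (ℚ.+-inverseʳ (seq y n)))))
  0<ε

≃-refl : ∀ {x} → x ≃ x
≃-refl {x} = ≗⇒≃ {x} {x} λ _ → refl

≃-sym : ∀ {x y} → x ≃ y → y ≃ x
≃-sym {x} {y} x≃y ε 0<ε = eventually-map
  (λ n → subst (ℚ._< ε) (∣p-q∣≡∣q-p∣ (seq x n) (seq y n))) (x≃y ε 0<ε)

≃-trans : ∀ {x y z} → x ≃ y → y ≃ z → x ≃ z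
≃-trans {x} {y} {z} x≃y y≃z ε 0<ε = eventually-map
  (λ n (x~y , y~z) → let a = seq x n; b = seq y n; c = seq z n in
    sum<ε (ℚ.∣p+q∣≤∣p∣+∣q∣ (a ℚ.- b) (b ℚ.- c))
          (cong ℚ.∣_∣ (solve 3 (λ a b c → a :- c := (a :- b) :+ (b :- c)) refl a b c))
          x~y y~z)
  (eventually-× (x≃y (½ ℚ.* ε) (half>0 0<ε)) (y≃z (½ ℚ.* ε) (half>0 0<ε)))
  where open +-*-Solver

+-cong : ∀ {x x′ y y′} → x ≃ x′ → y ≃ y′ → x +ᴿ y ≃ x′ +ᴿ y′
+-cong {x} {x′} {y} {y′} x≃ y≃ ε 0<ε = eventually-map
  (λ n (x~ , y~) → let a = seq x n; a′ = seq x′ n; b = seq y n; b′ = seq y′ n in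
    sum<ε (ℚ.∣p+q∣≤∣p∣+∣q∣ (a ℚ.- a′) (b ℚ.- b′))
          (cong ℚ.∣_∣ (solve 4 (λ a a′ b b′ →
            (a :+ b) :- (a′ :+ b′) := (a :- a′) :+ (b :- b′)) refl a a′ b b′))
          x~ y~)
  (eventually-× (x≃ (½ ℚ.* ε) (half>0 0<ε)) (y≃ (½ ℚ.* ε) (half>0 0<ε)))
  where open +-*-Solver

*-cong : ∀ {x x′ y y′} → x ≃ x′ → y ≃ y′ → x *ᴿ y ≃ x′ *ᴿ y′
*-cong {x} {x′} {y} {y′} x≃ y≃ ε 0<ε =
  let (A , A>0 , boundˣ) = eventually-bounded x
      (B , B>0 , boundʸ) = eventually-bounded y′
      (δ , 0<δ , A*δ≡)   = rescale A A>0 (half>0 0<ε)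
      (η , 0<η , B*η≡)   = rescale B B>0 (half>0 0<ε)
  in eventually-map
    (λ n ((x< , y<) , (x~ , y~)) → let a = seq x n; a′ = seq x′ n; b = seq y n; b′ = seq y′ n in
      sum<ε (ℚ.∣p+q∣≤∣p∣+∣q∣ (a ℚ.* (b ℚ.- b′)) (b′ ℚ.* (a ℚ.- a′)))
            (cong ℚ.∣_∣ (solve 4 (λ a a′ b b′ →
              (a :* b) :- (a′ :* b′) := (a :* (b :- b′)) :+ (b′ :* (a :- a′))) refl a a′ b b′))
            (product-bound {a} A>0 x< y~ A*δ≡)
            (product-bound {b′} B>0 y< x~ B*η≡))
    (eventually-× (eventually-× boundˣ boundʸ) (eventually-× (x≃ η 0<η) (y≃ δ 0<δ)))
  where open +-*-Solver

neg-cong : ∀ {x y} → x ≃ y → -ᴿ x ≃ -ᴿ y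
neg-cong {x} {y} x≃y ε 0<ε = eventually-map
  (λ n → subst (ℚ._< ε) (trans (∣p-q∣≡∣q-p∣ (seq x n) (seq y n))
    (cong ℚ.∣_∣ (solve 2 (λ a b → b :- a := :- a :- :- b) refl (seq x n) (seq y n)))))
  (x≃y ε 0<ε)
  where open +-*-Solver

-- _≃_ and the operations of Defs unfold during unification, which would prevent Agda from
-- inferring their arguments; hence this wrapper and the opaque copies of the operations.
infix 4 _≈_

record _≈_ (x y : ℝ) : Set where
  constructor ⟦_⟧
  field ⟪_⟫ : x ≃ y

open _≈_

infixl 6 _+_ _-_
infixl 7 _*_
infix  8 -_

opaque
  _+_ _*_ : ℝ → ℝ → ℝ
  _+_ = _+ᴿ_
  _*_ = _*ᴿ_

  -_ : ℝ → ℝ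
  -_ = -ᴿ_

_-_ : ℝ → ℝ → ℝ
x - y = x + - y

pointwise : ∀ {x y} → (∀ n → seq x n ≡ seq y n) → x ≈ y
pointwise {x} {y} x≗y = ⟦ ≗⇒≃ {x} {y} x≗y ⟧

opaque
  unfolding _+_ _*_ -_

  seq-+ : ∀ x y n → seq (x + y) n ≡ seq x n ℚ.+ seq y n
  seq-+ x y n = refl

  seq-* : ∀ x y n → seq (x * y) n ≡ seq x n ℚ.* seq y n
  seq-* x y n = refl

  seq-neg : ∀ x n → seq (- x) n ≡ ℚ.- seq x n
  seq-neg x n = refl

  ≈-isEquivalence : IsEquivalence _≈_
  ≈-isEquivalence = record
    { refl  = λ {x} → ⟦ ≃-refl {x} ⟧
    ; sym   = λ {x} {y} x≈y → ⟦ ≃-sym {x} {y} ⟪ x≈y ⟫ ⟧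
    ; trans = λ {x} {y} {z} x≈y y≈z → ⟦ ≃-trans {x} {y} {z} ⟪ x≈y ⟫ ⟪ y≈z ⟫ ⟧
    }

  +-*-isCommutativeRing : IsCommutativeRing _≈_ _+_ _*_ -_ 0ℝ 1ℝ
  +-*-isCommutativeRing = record
    { isRing = record
      { +-isAbelianGroup = record
        { isGroup = record
          { isMonoid = record
            { isSemigroup = record
              { isMagma = record
                { isEquivalence = ≈-isEquivalence
                ; ∙-cong = λ {x} {x′} {y} {y′} x≈ y≈ → ⟦ +-cong {x} {x′} {y} {y′} ⟪ x≈ ⟫ ⟪ y≈ ⟫ ⟧
                }
              ; assoc = λ x y z → pointwise λ n → ℚ.+-assoc (seq x n) (seq y n) (seq z n)
              }
            ; identity = (λ x → pointwise λ n → ℚ.+-identityˡ (seq x n))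
                       , (λ x → pointwise λ n → ℚ.+-identityʳ (seq x n))
            }
          ; inverse = (λ x → pointwise λ n → ℚ.+-inverseˡ (seq x n))
                    , (λ x → pointwise λ n → ℚ.+-inverseʳ (seq x n))
          ; ⁻¹-cong = λ {x} {y} x≈y → ⟦ neg-cong {x} {y} ⟪ x≈y ⟫ ⟧
          }
        ; comm = λ x y → pointwise λ n → ℚ.+-comm (seq x n) (seq y n)
        }
      ; *-cong = λ {x} {x′} {y} {y′} x≈ y≈ → ⟦ *-cong {x} {x′} {y} {y′} ⟪ x≈ ⟫ ⟪ y≈ ⟫ ⟧
      ; *-assoc = λ x y z → pointwise λ n → ℚ.*-assoc (seq x n) (seq y n) (seq z n)
      ; *-identity = (λ x → pointwise λ n → ℚ.*-identityˡ (seq x n))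
                   , (λ x → pointwise λ n → ℚ.*-identityʳ (seq x n))
      ; distrib = (λ x y z → pointwise λ n → ℚ.*-distribˡ-+ (seq x n) (seq y n) (seq z n))
                , (λ x y z → pointwise λ n → ℚ.*-distribʳ-+ (seq x n) (seq y n) (seq z n))
      }
    ; *-comm = λ x y → pointwise λ n → ℚ.*-comm (seq x n) (seq y n)
    }

  fromℚ-+ : ∀ p q → fromℚ (p ℚ.+ q) ≈ fromℚ p + fromℚ q
  fromℚ-+ p q = pointwise λ _ → refl

  fromℚ-* : ∀ p q → fromℚ (p ℚ.* q) ≈ fromℚ p * fromℚ q
  fromℚ-* p q = pointwise λ _ → refl

  fromℚ-neg : ∀ p → fromℚ (ℚ.- p) ≈ - fromℚ p
  fromℚ-neg p = pointwise λ _ → refl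

ℝ-commutativeRing : CommutativeRing 0ℓ 0ℓ
ℝ-commutativeRing = record { isCommutativeRing = +-*-isCommutativeRing }

module ℝ-Ring = CommutativeRing ℝ-commutativeRing
module ℝ-Group = GroupProperties ℝ-Ring.+-group
module ≈ = IsEquivalence ≈-isEquivalence
module ≈-Reasoning = SetoidReasoning ℝ-Ring.setoid

fromℚ-homomorphism : ℚ.+-*-rawRing -Raw-AlmostCommutative⟶ fromCommutativeRing ℝ-commutativeRing
fromℚ-homomorphism = record
  { ⟦_⟧    = fromℚ
  ; +-homo = fromℚ-+
  ; *-homo = fromℚ-*
  ; -‿homo = fromℚ-neg
  ; 0-homo = ≈.refl
  ; 1-homo = ≈.refl
  }

fromℚ-≟ : ∀ p q → Maybe (fromℚ p ≈ fromℚ q)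
fromℚ-≟ p q = Maybe.map (≈.reflexive ∘ cong fromℚ) (dec⇒maybe (p ℚ.≟ q))

module ℝ-Solver =
  RingSolver ℚ.+-*-rawRing (fromCommutativeRing ℝ-commutativeRing) fromℚ-homomorphism fromℚ-≟

infixl 6 _⟨+⟩_ _⟨-⟩_
infixl 7 _⟨*⟩_

_⟨+⟩_ : ∀ {x x′ y y′} → x ≈ x′ → y ≈ y′ → x + y ≈ x′ + y′
_⟨+⟩_ = ℝ-Ring.+-cong

_⟨*⟩_ : ∀ {x x′ y y′} → x ≈ x′ → y ≈ y′ → x * y ≈ x′ * y′
_⟨*⟩_ = ℝ-Ring.*-cong

_⟨-⟩_ : ∀ {x x′ y y′} → x ≈ x′ → y ≈ y′ → x - y ≈ x′ - y′
x≈ ⟨-⟩ y≈ = x≈ ⟨+⟩ ℝ-Ring.-‿cong y≈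

x≈y⇒x-y≈0 : ∀ {x y} → x ≈ y → x - y ≈ 0ℝ
x≈y⇒x-y≈0 = ℝ-Group.x≈y⇒x∙y⁻¹≈ε

x-y≈0⇒x≈y : ∀ {x y} → x - y ≈ 0ℝ → x ≈ y
x-y≈0⇒x≈y {x} {y} = ℝ-Group.x∙y⁻¹≈ε⇒x≈y x y

-- The sequences are constant, so closeness within the tolerance `∣ p - q ∣` itself would read
-- `∣ p - q ∣ < ∣ p - q ∣`.
fromℚ-injective : ∀ {p q} → fromℚ p ≈ fromℚ q → p ≡ q
fromℚ-injective {p} {q} ⟦ p≃q ⟧ with p ℚ.- q ℚ.≟ 0ℚ
... | yes p-q≡0 = ℚ-Group.x∙y⁻¹≈ε⇒x≈y p q p-q≡0
... | no  p-q≢0 = contradiction (proj₂ far (proj₁ far) ℕ.≤-refl) (ℚ.<-irrefl refl)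
  where
  0<∣p-q∣ : 0ℚ ℚ.< ℚ.∣ p ℚ.- q ∣
  0<∣p-q∣ = ℚ.≰⇒> λ ∣p-q∣≤0 →
    p-q≢0 (ℚ.∣p∣≡0⇒p≡0 (p ℚ.- q) (ℚ.≤-antisym ∣p-q∣≤0 (ℚ.0≤∣p∣ (p ℚ.- q))))
  far = p≃q _ 0<∣p-q∣

-- Strict positivity carries an explicit rational bound, because the reciprocal needs one to be a
-- Cauchy sequence.
record Pos (x : ℝ) : Set where
  constructor bounded-below
  field
    bound       : ℚ
    0<bound     : 0ℚ ℚ.< bound
    eventually≥ : EventuallyForAll λ n → bound ℚ.≤ seq x n

Pos-resp-≈ : ∀ {x y} → x ≈ y → Pos x → Pos y
Pos-resp-≈ {x} {y} ⟦ x≃y ⟧ (bounded-below ε 0<ε ε≤x) = bounded-below (½ ℚ.* ε) (half>0 0<ε) $ eventually-map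
  (λ n (ε≤xₙ , x~y) → r+s≤p⇒r≤q {p = seq x n} {seq y n}
    (subst (ℚ._≤ seq x n) (sym (half+half ε)) ε≤xₙ) x~y)
  (eventually-× ε≤x (x≃y (½ ℚ.* ε) (half>0 0<ε)))

Pos-+ : ∀ {x y} → Pos x → Pos y → Pos (x + y)
Pos-+ {x} {y} (bounded-below ε 0<ε ε≤x) (bounded-below δ 0<δ δ≤y) =
  bounded-below (ε ℚ.+ δ) (ℚ.+-mono-< 0<ε 0<δ) $
  eventually-map (λ n (ε≤ , δ≤) → subst (_ ℚ.≤_) (sym (seq-+ x y n)) (ℚ.+-mono-≤ ε≤ δ≤))
    (eventually-× ε≤x δ≤y)

*-mono-≤-nonneg : ∀ {p q r s} → 0ℚ ℚ.≤ r → 0ℚ ℚ.≤ q → p ℚ.≤ q → r ℚ.≤ s → p ℚ.* r ℚ.≤ q ℚ.* s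
*-mono-≤-nonneg {p} {q} {r} {s} 0≤r 0≤q p≤q r≤s = ℚ.≤-trans
  (ℚ.*-monoʳ-≤-nonNeg r {{ℚ.nonNegative 0≤r}} p≤q)
  (ℚ.*-monoˡ-≤-nonNeg q {{ℚ.nonNegative 0≤q}} r≤s)

0<p*q : ∀ {p q} → 0ℚ ℚ.< p → 0ℚ ℚ.< q → 0ℚ ℚ.< p ℚ.* q
0<p*q {p} {q} 0<p 0<q = subst (ℚ._< p ℚ.* q) (ℚ.*-zeroʳ p)
  (ℚ.*-monoʳ-<-pos p {{ℚ.positive 0<p}} 0<q)

Pos-* : ∀ {x y} → Pos x → Pos y → Pos (x * y)
Pos-* {x} {y} (bounded-below ε 0<ε ε≤x) (bounded-below δ 0<δ δ≤y) = bounded-below (ε ℚ.* δ) (0<p*q 0<ε 0<δ) $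
  eventually-map
    (λ n (ε≤ , δ≤) → subst (_ ℚ.≤_) (sym (seq-* x y n)) $
      *-mono-≤-nonneg (ℚ.<⇒≤ 0<δ) (ℚ.≤-trans (ℚ.<⇒≤ 0<ε) ε≤) ε≤ δ≤)
    (eventually-× ε≤x δ≤y)

Pos-1ℝ : Pos 1ℝ
Pos-1ℝ = bounded-below 1ℚ (ℚ.positive⁻¹ 1ℚ) (0 , λ _ _ → ℚ.≤-refl)

Pos⇒≉0 : ∀ {x} → Pos x → ¬ x ≈ 0ℝ
Pos⇒≉0 Pos-x x≈0 = ¬Pos-0ℝ (Pos-resp-≈ x≈0 Pos-x)
  where
  ¬Pos-0ℝ : ¬ Pos 0ℝ
  ¬Pos-0ℝ (bounded-below ε 0<ε (N , ε≤0)) = ℚ.<-irrefl {0ℚ} refl (ℚ.<-≤-trans 0<ε (ε≤0 N ℕ.≤-refl))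

-- A Cauchy sequence cannot keep away from zero without a definite sign, and smallness of a late
-- term is decidable.
tight : ∀ {x} → ¬ Pos x → ¬ Pos (- x) → x ≈ 0ℝ
tight {x} ¬Pos-x ¬Pos-[-x] = ⟦ x≃0 ⟧
  where
  x≃0 : x ≃ 0ℝ
  x≃0 ε 0<ε with cauchy x h 0<h
    where
    h = ½ ℚ.* (½ ℚ.* ε)
    0<h = half>0 (half>0 0<ε)
  ... | N , close with ℚ.∣ seq x N ∣ ℚ.<? ½ ℚ.* ε
  ... | yes small = N , λ n N≤n →
    sum<ε (ℚ.∣p+q∣≤∣p∣+∣q∣ (seq x n ℚ.- seq x N) (seq x N))
          (cong ℚ.∣_∣ (solve 2 (λ a b → a :- con 0ℚ := (a :- b) :+ b) refl (seq x n) (seq x N)))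
          (ℚ.<-trans (close n N N≤n ℕ.≤-refl)
            (subst (½ ℚ.* (½ ℚ.* ε) ℚ.<_) (half+half (½ ℚ.* ε))
              (subst (ℚ._< ½ ℚ.* (½ ℚ.* ε) ℚ.+ ½ ℚ.* (½ ℚ.* ε)) (ℚ.+-identityʳ (½ ℚ.* (½ ℚ.* ε)))
                (ℚ.+-monoʳ-< (½ ℚ.* (½ ℚ.* ε)) (half>0 (half>0 0<ε))))))
          small
    where open +-*-Solver
  ... | no ¬small = contradiction (ℚ.∣p∣≡p∨∣p∣≡-p (seq x N))
    [ (λ eq → ¬Pos-x (bounded-below h (half>0 (half>0 0<ε)) (N , λ n N≤n →
        r+s≤p⇒r≤q (subst (ℚ._≤ seq x N) (sym (half+half (½ ℚ.* ε)))
            (subst (½ ℚ.* ε ℚ.≤_) eq (ℚ.≮⇒≥ ¬small)))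
          (close N n ℕ.≤-refl N≤n))))
    , (λ eq → ¬Pos-[-x] (bounded-below h (half>0 (half>0 0<ε)) (N , λ n N≤n →
        r+s≤p⇒r≤q (subst (ℚ._≤ ℚ.- seq x N) (sym (half+half (½ ℚ.* ε)))
            (subst (½ ℚ.* ε ℚ.≤_) eq (ℚ.≮⇒≥ ¬small)))
          (subst (λ p → ℚ.∣ ℚ.- seq x N ℚ.- p ∣ ℚ.< h) (sym (seq-neg x n)) (subst (ℚ._< h)
            (cong ℚ.∣_∣ (solve 2 (λ a b → a :- b := :- b :- :- a) refl (seq x n) (seq x N)))
            (close n N N≤n ℕ.≤-refl))))))
    ]′
    where
    h = ½ ℚ.* (½ ℚ.* ε)
    open +-*-Solver

-- Once both strict signs are refuted, `tight` supplies the remaining case.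
trichotomy : ∀ x → ¬ ¬ (Pos x ⊎ x ≈ 0ℝ ⊎ Pos (- x))
trichotomy x k = k (inj₂ (inj₁ (tight (k ∘ inj₁) (k ∘ inj₂ ∘ inj₂))))

-- By `tight`, being zero follows from two negations. Equations may thus be proved by case
-- distinctions that hold only under double negation.
≈-stable : ∀ {x y} → ¬ ¬ x ≈ y → x ≈ y
≈-stable {x} {y} ¬¬x≈y = x-y≈0⇒x≈y (tight
  (λ Pos-x-y → ¬¬x≈y (Pos⇒≉0 Pos-x-y ∘ x≈y⇒x-y≈0))
  (λ Pos-y-x → ¬¬x≈y (λ x≈y → Pos⇒≉0 (Pos-resp-≈ swap Pos-y-x) (x≈y⇒x-y≈0 (≈.sym x≈y)))))
  where
  open ℝ-Solver
  swap : - (x - y) ≈ y - x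
  swap = solve 2 (λ x y → :- (x :- y) := y :- x) ≈.refl x y

module Reciprocal {p : ℚ} (0<p : 0ℚ ℚ.< p) where
  recip : ℚ
  recip = (ℚ.1/ p) {{ℚ.>-nonZero 0<p}}

  p*recip≡1 : p ℚ.* recip ≡ 1ℚ
  p*recip≡1 = ℚ.*-inverseʳ p {{ℚ.>-nonZero 0<p}}

  0<recip : 0ℚ ℚ.< recip
  0<recip = ℚ.positive⁻¹ recip {{ℚ.1/pos⇒pos p {{ℚ.positive 0<p}}}}

open Reciprocal

recip-anti : ∀ {p q} (0<p : 0ℚ ℚ.< p) (0<q : 0ℚ ℚ.< q) → p ℚ.≤ q → recip 0<q ℚ.≤ recip 0<p
recip-anti {p} {q} 0<p 0<q p≤q = begin
  q⁻¹                  ≡⟨ ℚ.*-identityʳ q⁻¹ ⟨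
  q⁻¹ ℚ.* 1ℚ           ≡⟨ cong (q⁻¹ ℚ.*_) (p*recip≡1 0<p) ⟨
  q⁻¹ ℚ.* (p ℚ.* p⁻¹)  ≤⟨ ℚ.*-monoˡ-≤-nonNeg q⁻¹ {{ℚ.nonNegative (ℚ.<⇒≤ (0<recip 0<q))}}
                           (ℚ.*-monoʳ-≤-nonNeg p⁻¹ {{ℚ.nonNegative (ℚ.<⇒≤ (0<recip 0<p))}} p≤q) ⟩
  q⁻¹ ℚ.* (q ℚ.* p⁻¹)  ≡⟨ solve 3 (λ a b c → a :* (b :* c) := (b :* a) :* c) refl q⁻¹ q p⁻¹ ⟩
  (q ℚ.* q⁻¹) ℚ.* p⁻¹  ≡⟨ cong (ℚ._* p⁻¹) (p*recip≡1 0<q) ⟩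
  1ℚ ℚ.* p⁻¹           ≡⟨ ℚ.*-identityˡ p⁻¹ ⟩
  p⁻¹                  ∎
  where
  open ℚ.≤-Reasoning
  open +-*-Solver
  p⁻¹ = recip 0<p
  q⁻¹ = recip 0<q

-- The terms of x are clamped below by its positive bound so that every one of them is invertible.
module _ {x : ℝ} (Pos-x : Pos x) where
  open Pos Pos-x

  private
    clamped : ℕ → ℚ
    clamped n = bound ℚ.⊔ seq x n

    0<clamped : ∀ n → 0ℚ ℚ.< clamped n
    0<clamped n = ℚ.<-≤-trans 0<bound (ℚ.p≤p⊔q bound (seq x n))

    clamped⁻¹ : ℕ → ℚ
    clamped⁻¹ n = recip (0<clamped n)

    B : ℚ
    B = 1ℚ ℚ.+ recip 0<bound

    B>0 : ℚ.Positive B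
    B>0 = ℚ.positive (ℚ.+-mono-< (ℚ.positive⁻¹ 1ℚ) (0<recip 0<bound))

    ∣clamped⁻¹∣<B : ∀ n → ℚ.∣ clamped⁻¹ n ∣ ℚ.< B
    ∣clamped⁻¹∣<B n = begin-strict
      ℚ.∣ clamped⁻¹ n ∣   ≡⟨ ℚ.0≤p⇒∣p∣≡p (ℚ.<⇒≤ (0<recip (0<clamped n))) ⟩
      clamped⁻¹ n         ≤⟨ recip-anti 0<bound (0<clamped n) (ℚ.p≤p⊔q bound (seq x n)) ⟩
      recip 0<bound       ≡⟨ ℚ.+-identityˡ (recip 0<bound) ⟨
      0ℚ ℚ.+ recip 0<bound  <⟨ ℚ.+-monoˡ-< (recip 0<bound) (ℚ.positive⁻¹ 1ℚ) ⟩
      B                   ∎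
      where open ℚ.≤-Reasoning

    clamped⁻¹-diff : ∀ m n → clamped⁻¹ m ℚ.- clamped⁻¹ n ≡
                     clamped⁻¹ m ℚ.* (clamped⁻¹ n ℚ.* (clamped n ℚ.- clamped m))
    clamped⁻¹-diff m n = begin
      r ℚ.- s
        ≡⟨ solve 2 (λ r s → r :- s := r :* con 1ℚ :- s :* con 1ℚ) refl r s ⟩
      r ℚ.* 1ℚ ℚ.- s ℚ.* 1ℚ
        ≡⟨ cong₂ (λ u v → r ℚ.* u ℚ.- s ℚ.* v) (p*recip≡1 (0<clamped n)) (p*recip≡1 (0<clamped m)) ⟨
      r ℚ.* (b ℚ.* s) ℚ.- s ℚ.* (a ℚ.* r)
        ≡⟨ solve 4 (λ a b r s → r :* (b :* s) :- s :* (a :* r) := r :* (s :* (b :- a))) refl a b r s ⟩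
      r ℚ.* (s ℚ.* (b ℚ.- a))                ∎
      where
      open ≡-Reasoning
      open +-*-Solver
      a = clamped m
      b = clamped n
      r = clamped⁻¹ m
      s = clamped⁻¹ n

    clamped≡ : EventuallyForAll λ n → clamped n ≡ seq x n
    clamped≡ = eventually-map (λ _ → ℚ.p≤q⇒p⊔q≡q) eventually≥

    inverse-cauchy : ∀ ε → 0ℚ ℚ.< ε → ∃ λ N → ∀ m n → N ℕ.≤ m → N ℕ.≤ n →
                     ℚ.∣ clamped⁻¹ m ℚ.- clamped⁻¹ n ∣ ℚ.< ε
    inverse-cauchy ε 0<ε =
      let (δ , 0<δ , B*δ≡ε) = rescale B B>0 0<ε
          (η , 0<η , B*η≡δ) = rescale B B>0 0<δ
          (M , close)       = cauchy x η 0<η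
          (K , ≡x)          = clamped≡
      in M ℕ.⊔ K , λ m n ≤m ≤n →
        subst (λ d → ℚ.∣ d ∣ ℚ.< ε) (sym (clamped⁻¹-diff m n))
          (product-bound {clamped⁻¹ m} B>0 (∣clamped⁻¹∣<B m)
            (product-bound {clamped⁻¹ n} B>0 (∣clamped⁻¹∣<B n)
              (subst₂ (λ a b → ℚ.∣ b ℚ.- a ∣ ℚ.< η)
                (sym (≡x m (ℕ.m⊔n≤o⇒n≤o M K ≤m))) (sym (≡x n (ℕ.m⊔n≤o⇒n≤o M K ≤n)))
                (close n m (ℕ.m⊔n≤o⇒m≤o M K ≤n) (ℕ.m⊔n≤o⇒m≤o M K ≤m)))
              B*η≡δ)
            B*δ≡ε)

    inverse : ℝ
    inverse = mkℝ clamped⁻¹ inverse-cauchy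

    inverse-* : inverse * x ≈ 1ℝ
    inverse-* = ⟦ (λ ε 0<ε → eventually-map (λ n eq → subst (ℚ._< ε)
      (sym (cong (λ d → ℚ.∣ d ℚ.- 1ℚ ∣)
        (trans (seq-* inverse x n) (trans (cong (clamped⁻¹ n ℚ.*_) (sym eq))
          (trans (ℚ.*-comm (clamped⁻¹ n) (clamped n)) (p*recip≡1 (0<clamped n)))))))
      0<ε) clamped≡) ⟧

    inverse-Pos : Pos inverse
    inverse-Pos =
      let (C , C>0 , ∣x∣<C) = eventually-bounded x
          0<C               = ℚ.positive⁻¹ C {{C>0}}
      in bounded-below (recip 0<C) (0<recip 0<C) $ eventually-map
        (λ n (eq , ∣xₙ∣<C) → recip-anti (0<clamped n) 0<C
          (subst (ℚ._≤ C) (sym eq) (ℚ.≤-trans (p≤∣p∣ (seq x n)) (ℚ.<⇒≤ ∣xₙ∣<C))))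
        (eventually-× clamped≡ ∣x∣<C)

  opaque
    reciprocal : ∃ λ y → Pos y × y * x ≈ 1ℝ
    reciprocal = inverse , inverse-Pos , inverse-*

Pos⇒≤ : ∀ {x y} → Pos (y - x) → x ≤ᴿ y
Pos⇒≤ {x} {y} (bounded-below δ 0<δ δ≤y-x) ε 0<ε = eventually-map (λ n δ≤ → begin-strict
  seq x n                           ≡⟨ ℚ.+-identityʳ (seq x n) ⟨
  seq x n ℚ.+ 0ℚ                    ≤⟨ ℚ.+-monoʳ-≤ (seq x n) (ℚ.≤-trans (ℚ.<⇒≤ 0<δ) δ≤) ⟩
  seq x n ℚ.+ seq (y - x) n         ≡⟨ cong (seq x n ℚ.+_)
    (trans (seq-+ y (- x) n) (cong (seq y n ℚ.+_) (seq-neg x n))) ⟩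
  seq x n ℚ.+ (seq y n ℚ.- seq x n) ≡⟨ solve 2 (λ a b → a :+ (b :- a) := b) refl (seq x n) (seq y n) ⟩
  seq y n                           ≡⟨ ℚ.+-identityʳ (seq y n) ⟨
  seq y n ℚ.+ 0ℚ                    <⟨ ℚ.+-monoʳ-< (seq y n) 0<ε ⟩
  seq y n ℚ.+ ε                     ∎) δ≤y-x
  where open ℚ.≤-Reasoning
        open +-*-Solver

≈⇒≤ : ∀ {x y} → x ≈ y → x ≤ᴿ y
≈⇒≤ {x} {y} ⟦ x≃y ⟧ ε 0<ε =
  eventually-map (λ n → ∣p-q∣<r⇒p<q+r {seq x n} {seq y n}) (x≃y ε 0<ε)

-- Plane geometry

infix 4 _≋_
infixr 7 _·_
infix 8 _⇀_

_⇀_ : Point → Point → Point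
(x₁ , y₁) ⇀ (x₂ , y₂) = x₂ - x₁ , y₂ - y₁

_·_ : ℝ → Point → Point
c · (x , y) = c * x , c * y

record _≋_ (u v : Point) : Set where
  constructor _,_
  field
    x≈ : proj₁ u ≈ proj₁ v
    y≈ : proj₂ u ≈ proj₂ v

module _ where
  open ℝ-Solver using (solve; _:+_; _:-_; _:*_; :-_; _:=_; con)
  open ≈-Reasoning

  invert : ∀ {x} → ¬ x ≈ 0ℝ → ¬ ¬ (∃ λ y → y * x ≈ 1ℝ)
  invert {x} x≉0 k = trichotomy x λ
    { (inj₁ Pos-x)           → let (y , _ , y*x≈1) = reciprocal Pos-x in k (y , y*x≈1)
    ; (inj₂ (inj₁ x≈0))     → x≉0 x≈0
    ; (inj₂ (inj₂ Pos-[-x])) → let (y , _ , y*-x≈1) = reciprocal Pos-[-x] in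
        k (- y , ≈.trans (solve 2 (λ x y → :- y :* x := y :* :- x) ≈.refl x y) y*-x≈1)
    }

  divide : ∀ {x y z w} → y * x ≈ 1ℝ → x * z ≈ w → z ≈ y * w
  divide {x} {y} {z} {w} y*x≈1 x*z≈w = begin
    z            ≈⟨ ℝ-Ring.*-identityˡ z ⟨
    1ℝ * z       ≈⟨ y*x≈1 ⟨*⟩ ≈.refl ⟨
    y * x * z    ≈⟨ ℝ-Ring.*-assoc y x z ⟩
    y * (x * z)  ≈⟨ ≈.refl ⟨*⟩ x*z≈w ⟩
    y * w        ∎

  cancel-factor : ∀ {x z} → ¬ x ≈ 0ℝ → x * z ≈ 0ℝ → z ≈ 0ℝ
  cancel-factor x≉0 x*z≈0 = ≈-stable λ z≉0 → invert x≉0 λ (y , y*x≈1) →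
    z≉0 (≈.trans (divide y*x≈1 x*z≈0) (ℝ-Ring.zeroʳ y))

opaque
  unfolding _+_ _*_ -_

  affine⁺ : ∀ {a b c} t → c ≈ a + t * (b - a) → c ≃ a +ᴿ t *ᴿ (b -ᴿ a)
  affine⁺ _ c≈ = ⟪ c≈ ⟫

  affine⁻ : ∀ {a b c} t → c ≃ a +ᴿ t *ᴿ (b -ᴿ a) → c ≈ a + t * (b - a)
  affine⁻ _ c≃ = ⟦ c≃ ⟧

  linear⁻ : ∀ {a b c d} m → d -ᴿ c ≃ m *ᴿ (b -ᴿ a) → d - c ≈ m * (b - a)
  linear⁻ _ eq = ⟦ eq ⟧

module _ where
  open ℝ-Solver using (solve; _:+_; _:-_; _:*_; :-_; _:=_; con)
  open ≈-Reasoning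

  segment⁺ : ∀ {p q r} t → 0ℝ ≤ᴿ t → t ≤ᴿ 1ℝ → p ⇀ r ≋ t · p ⇀ q → OnSegment p q r
  segment⁺ t 0≤t t≤1 (x≈ , y≈) = t , 0≤t , t≤1 , affine⁺ t (move x≈) , affine⁺ t (move y≈)
    where
    move : ∀ {a c d} → c - a ≈ d → c ≈ a + d
    move {a} {c} eq = ≈.trans (solve 2 (λ a c → c := a :+ (c :- a)) ≈.refl a c) (≈.refl ⟨+⟩ eq)

  segment⁻ : ∀ {p q r} → OnSegment p q r → ∃ λ t → 0ℝ ≤ᴿ t × t ≤ᴿ 1ℝ × p ⇀ r ≋ t · p ⇀ q
  segment⁻ (t , 0≤t , t≤1 , x≃ , y≃) = t , 0≤t , t≤1 , (move (affine⁻ t x≃) , move (affine⁻ t y≃))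
    where
    move : ∀ {a c d} → c ≈ a + d → c - a ≈ d
    move {a} {c} {d} eq = ≈.trans (eq ⟨-⟩ ≈.refl) (solve 2 (λ a d → a :+ d :- a := d) ≈.refl a d)

  segment-homothety : ∀ {c o p q o′ p′ q′} → o′ ⇀ p′ ≋ c · o ⇀ p → o′ ⇀ q′ ≋ c · o ⇀ q →
                      OnSegment o p q → OnSegment o′ p′ q′
  segment-homothety {c} (px , py) (qx , qy) q∈op =
    let (t , 0≤t , t≤1 , x≈ , y≈) = segment⁻ q∈op
    in segment⁺ t 0≤t t≤1 (scale px qx x≈ , scale py qy y≈)
    where
    scale : ∀ {t u v u′ v′} → u′ ≈ c * u → v′ ≈ c * v → v ≈ t * u → v′ ≈ t * u′
    scale {t} {u} {v} {u′} {v′} u′≈ v′≈ v≈ = begin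
      v′           ≈⟨ v′≈ ⟩
      c * v        ≈⟨ ≈.refl ⟨*⟩ v≈ ⟩
      c * (t * u)  ≈⟨ solve 3 (λ c t u → c :* (t :* u) := t :* (c :* u)) ≈.refl c t u ⟩
      t * (c * u)  ≈⟨ ≈.refl ⟨*⟩ u′≈ ⟨
      t * u′       ∎

  NonNeg : ℝ → Set
  NonNeg c = Pos c ⊎ c ≈ 0ℝ

  NonNeg⇒0≤ : ∀ {c} → NonNeg c → 0ℝ ≤ᴿ c
  NonNeg⇒0≤ {c} (inj₁ 0<c) = Pos⇒≤ (Pos-resp-≈ (solve 1 (λ c → c := c :- con 0ℚ) ≈.refl c) 0<c)
  NonNeg⇒0≤ (inj₂ c≈0) = ≈⇒≤ (≈.sym c≈0)

  reciprocal≤1 : ∀ {c i} → Pos i → i * c ≈ 1ℝ → Pos (- (1ℝ - c)) → i ≤ᴿ 1ℝ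
  reciprocal≤1 {c} {i} 0<i i*c≈1 1<c = Pos⇒≤ (Pos-resp-≈ (begin
    i * - (1ℝ - c)  ≈⟨ solve 2 (λ c i → i :* :- (con 1ℚ :- c) := i :* c :- i) ≈.refl c i ⟩
    i * c - i       ≈⟨ i*c≈1 ⟨-⟩ ≈.refl ⟩
    1ℝ - i          ∎) (Pos-* 0<i 1<c))

  -- If `c` is at most 1, it is the parameter of `q` on the segment from `o` to `p`; otherwise
  -- `1 / c` is the parameter of `p` on the segment from `o` to `q`. Comparing `c` with 1 costs the
  -- double negation.
  ray : ∀ {o p q c} → NonNeg c → o ⇀ q ≋ c · o ⇀ p → ¬ ¬ (OnSegment o p q ⊎ OnSegment o q p)
  ray {o} {p} {q} {c} 0≤c eq k = trichotomy (1ℝ - c)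
    [ k ∘ inj₁ ∘ near ∘ Pos⇒≤
    , [ k ∘ inj₁ ∘ near ∘ ≈⇒≤ ∘ ≈.sym ∘ x-y≈0⇒x≈y , k ∘ inj₂ ∘ far ]′ ]′
    where
    near : c ≤ᴿ 1ℝ → OnSegment o p q
    near c≤1 = segment⁺ c (NonNeg⇒0≤ 0≤c) c≤1 eq

    1<c⇒0<c : Pos (- (1ℝ - c)) → Pos c
    1<c⇒0<c 1<c = Pos-resp-≈ (solve 1 (λ c →
        con 1ℚ :+ :- (con 1ℚ :- c) := c) ≈.refl c) (Pos-+ Pos-1ℝ 1<c)

    far : Pos (- (1ℝ - c)) → OnSegment o q p
    far 1<c =
      let (i , 0<i , i*c≈1) = reciprocal (1<c⇒0<c 1<c)
      in segment⁺ i (NonNeg⇒0≤ (inj₁ 0<i)) (reciprocal≤1 0<i i*c≈1 1<c)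
           (divide i*c≈1 (≈.sym (_≋_.x≈ eq)) , divide i*c≈1 (≈.sym (_≋_.y≈ eq)))

  -- For `κ` at least 0 the points `b` and `c` lie on one ray from `a`. For negative `κ` the points
  -- `a` and `c` lie on one ray from `b`, with factor `1 - κ`. In both cases `ray` puts one of the
  -- three points on a forbidden segment.
  noncollinear : ∀ {a b c} → ¬ OnSegment a b c → ¬ OnSegment a c b → ¬ OnSegment b a c → ¬ OnSegment b c a →
                 ∀ {κ} → ¬ a ⇀ c ≋ κ · a ⇀ b
  noncollinear {a} {b} {c} c∉ab b∉ac c∉ba a∉bc {κ} eq@(x≈ , y≈) = trichotomy κ λ
    { (inj₁ 0<κ)        → ray (inj₁ 0<κ) eq [ c∉ab , b∉ac ]′
    ; (inj₂ (inj₁ κ≈0)) → ray (inj₂ κ≈0) eq [ c∉ab , b∉ac ]′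
    ; (inj₂ (inj₂ κ<0)) → ray (inj₁ (Pos-+ Pos-1ℝ κ<0)) (reverse x≈ , reverse y≈) [ c∉ba , a∉bc ]′
    }
    where
    reverse : ∀ {x y z} → z - x ≈ κ * (y - x) → z - y ≈ (1ℝ - κ) * (x - y)
    reverse {x} {y} {z} eq = begin
      z - y                    ≈⟨ solve 3 (λ x y z → z :- y := (z :- x) :+ (x :- y)) ≈.refl x y z ⟩
      (z - x) + (x - y)        ≈⟨ eq ⟨+⟩ ≈.refl ⟩
      κ * (y - x) + (x - y)
        ≈⟨ solve 3 (λ x y κ → κ :* (y :- x) :+ (x :- y) := (con 1ℚ :- κ) :* (x :- y)) ≈.refl x y κ ⟩
      (1ℝ - κ) * (x - y)       ∎

  origin : ∀ {p q} → p ⇀ q ≋ (0ℝ , 0ℝ) → p ≈ₚ q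
  origin (x≈ , y≈) = ⟪ ≈.sym (x-y≈0⇒x≈y x≈) ⟫ , ⟪ ≈.sym (x-y≈0⇒x≈y y≈) ⟫

  -- Comparing a ⇀ c with a ⇀ b ⇀ c gives (s - t) (c - a) = (r - t) (b - a),
  -- so noncollinearity forces s = t and then r = t.
  rigid-triangle : ∀ {a b c a′ b′ c′ r s t} → (∀ {κ} → ¬ a ⇀ c ≋ κ · a ⇀ b) → ¬ a ≈ₚ b →
                   a′ ⇀ b′ ≋ r · a ⇀ b → a′ ⇀ c′ ≋ s · a ⇀ c → b′ ⇀ c′ ≋ t · b ⇀ c → r ≈ t
  rigid-triangle {a} {b} {c} {r = r} {s} {t} a≁c a≉b (ab₁ , ab₂) (ac₁ , ac₂) (bc₁ , bc₂) = r≈t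
    where
    relation : ∀ {x y z x′ y′ z′} → y′ - x′ ≈ r * (y - x) → z′ - x′ ≈ s * (z - x) → z′ - y′ ≈ t * (z - y) →
               (s - t) * (z - x) ≈ (r - t) * (y - x)
    relation {x} {y} {z} {x′} {y′} {z′} xy xz yz = begin
      (s - t) * (z - x)
        ≈⟨ solve 4 (λ s t x z → (s :- t) :* (z :- x) := s :* (z :- x) :- t :* (z :- x)) ≈.refl s t x z ⟩
      s * (z - x) - t * (z - x)               ≈⟨ xz ⟨-⟩ ≈.refl ⟨
      (z′ - x′) - t * (z - x)
        ≈⟨ solve 5 (λ x′ y′ z′ t d →
            (z′ :- x′) :- t :* d := (y′ :- x′) :+ (z′ :- y′) :- t :* d) ≈.refl x′ y′ z′ t (z - x) ⟩
      (y′ - x′) + (z′ - y′) - t * (z - x)     ≈⟨ (xy ⟨+⟩ yz) ⟨-⟩ ≈.refl ⟩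
      r * (y - x) + t * (z - y) - t * (z - x)
        ≈⟨ solve 5 (λ x y z r t →
            r :* (y :- x) :+ t :* (z :- y) :- t :* (z :- x) := (r :- t) :* (y :- x)) ≈.refl x y z r t ⟩
      (r - t) * (y - x)                       ∎

    s≈t : s ≈ t
    s≈t = ≈-stable λ s≉t → invert (s≉t ∘ x-y≈0⇒x≈y) λ (i , i*[s-t]≈1) →
      a≁c {i * (r - t)} (collinear i*[s-t]≈1 (relation ab₁ ac₁ bc₁) , collinear i*[s-t]≈1 (relation ab₂ ac₂ bc₂))
      where
      collinear : ∀ {u v i} → i * (s - t) ≈ 1ℝ → (s - t) * v ≈ (r - t) * u → v ≈ i * (r - t) * u
      collinear {u} {v} {i} i≈ eq = ≈.trans (divide i≈ eq) (≈.sym (ℝ-Ring.*-assoc i (r - t) u))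

    r≈t : r ≈ t
    r≈t = ≈-stable λ r≉t → a≉b (origin
      ( cancel-factor (r≉t ∘ x-y≈0⇒x≈y) (vanish (relation ab₁ ac₁ bc₁))
      , cancel-factor (r≉t ∘ x-y≈0⇒x≈y) (vanish (relation ab₂ ac₂ bc₂))))
      where
      vanish : ∀ {u v} → (s - t) * v ≈ (r - t) * u → (r - t) * u ≈ 0ℝ
      vanish {u} {v} eq = ≈.trans (≈.sym eq) (≈.trans (x≈y⇒x-y≈0 s≈t ⟨*⟩ ≈.refl) (ℝ-Ring.zeroˡ v))

  -- Dividing by `r` brings the third relation back to the first figure, where `q` lies on the ray
  -- from `o` through `p`. The second alternative of `ray` is then carried over to the primed
  -- figure: in the application `o p` is an edge of the first figure only and `o′ q′` of the second
  -- only, so each alternative is stated where edge avoidance can refute it.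
  same-ray : ∀ {o p q o′ p′ q′ r c} → Pos r → Pos c →
             o′ ⇀ p′ ≋ r · o ⇀ p → o′ ⇀ q′ ≋ r · o ⇀ q → o′ ⇀ q′ ≋ c · o ⇀ p →
             ¬ ¬ (OnSegment o p q ⊎ OnSegment o′ q′ p′)
  same-ray {r = r} {c} 0<r 0<c op oq@(oq₁ , oq₂) (eq₁ , eq₂) k =
    let (i , 0<i , i*r≈1) = reciprocal 0<r in
    ray (inj₁ (Pos-* 0<i 0<c)) (rescaled i*r≈1 oq₁ eq₁ , rescaled i*r≈1 oq₂ eq₂)
      [ k ∘ inj₁ , k ∘ inj₂ ∘ segment-homothety oq op ]′
    where
    rescaled : ∀ {i u v v′} → i * r ≈ 1ℝ → v′ ≈ r * v → v′ ≈ c * u → v ≈ i * c * u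
    rescaled {i} {u} i*r≈1 v′≈r*v v′≈c*u = ≈.trans (divide i*r≈1 (≈.trans (≈.sym v′≈r*v) v′≈c*u))
      (≈.sym (ℝ-Ring.*-assoc i c u))

-- The label of an edge is its slope together with the sign of the dominant coordinate, so that edges
-- with the same label differ by a positive factor.
Signed : Fin 2 → ℝ → Set
Signed zero    x = Pos x
Signed (suc _) x = Pos (- x)

dominant : Slope → Point → ℝ
dominant (just _) = proj₁
dominant nothing  = proj₂

Labelled : Slope → Fin 2 → Point → Point → Set
Labelled s b p q = HasSlope p q s × Signed b (dominant s (p ⇀ q))

module _ where
  open ≈-Reasoning
  open ℝ-Solver using (solve; _:+_; _:-_; _:*_; :-_; _:=_; con)

  signed : ∀ {x} → ¬ x ≈ 0ℝ → ¬ ¬ (∃ λ b → Signed b x)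
  signed {x} x≉0 k = trichotomy x λ
    { (inj₁ 0<x)        → k (zero , 0<x)
    ; (inj₂ (inj₁ x≈0)) → x≉0 x≈0
    ; (inj₂ (inj₂ x<0)) → k (suc zero , x<0)
    }

  labelled : ∀ s {p q} → HasSlope p q s → ¬ p ≈ₚ q → ¬ ¬ (∃ λ b → Labelled s b p q)
  labelled (just m) hs@(x≄ , _) p≉q k =
    signed (λ x≈0 → x≄ ⟪ ≈.sym (x-y≈0⇒x≈y x≈0) ⟫) λ (b , sgn) → k (b , hs , sgn)
  labelled nothing x≃ p≉q k =
    signed (λ y≈0 → p≉q (x≃ , ⟪ ≈.sym (x-y≈0⇒x≈y y≈0) ⟫)) λ (b , sgn) → k (b , x≃ , sgn)

  same-sign : ∀ b {x y} → Signed b x → Signed b y → ∃ λ c → Pos c × y ≈ c * x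
  same-sign zero {x} {y} 0<x 0<y =
    let (i , 0<i , i*x≈1) = reciprocal 0<x
    in y * i , Pos-* 0<y 0<i , (begin
      y            ≈⟨ ℝ-Ring.*-identityʳ y ⟨
      y * 1ℝ       ≈⟨ ≈.refl ⟨*⟩ i*x≈1 ⟨
      y * (i * x)  ≈⟨ ℝ-Ring.*-assoc y i x ⟨
      y * i * x    ∎)
  same-sign (suc _) {x} {y} x<0 y<0 =
    let (c , 0<c , -y≈c*-x) = same-sign zero x<0 y<0
    in c , 0<c , (begin
      y             ≈⟨ solve 1 (λ y → y := :- (:- y)) ≈.refl y ⟩
      - (- y)       ≈⟨ ℝ-Ring.-‿cong -y≈c*-x ⟩
      - (c * - x)   ≈⟨ solve 2 (λ c x → :- (c :* :- x) := c :* x) ≈.refl c x ⟩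
      c * x         ∎)

  -- Equal signs make the ratio of the dominant coordinates positive, and the common slope passes
  -- this ratio on to the other coordinate.
  same-label : ∀ s b {p q p′ q′} → Labelled s b p q → Labelled s b p′ q′ →
               ∃ λ c → Pos c × p′ ⇀ q′ ≋ c · p ⇀ q
  same-label (just m) b {p} {q} {p′} {q′} ((_ , y≃) , sgn) ((_ , y′≃) , sgn′) =
    let (c , 0<c , x′≈c*x) = same-sign b sgn sgn′
    in c , 0<c , (x′≈c*x , (begin
      dy′           ≈⟨ linear⁻ m y′≃ ⟩
      m * dx′       ≈⟨ ≈.refl ⟨*⟩ x′≈c*x ⟩
      m * (c * dx)  ≈⟨ solve 3 (λ m c x → m :* (c :* x) := c :* (m :* x)) ≈.refl m c dx ⟩
      c * (m * dx)  ≈⟨ ≈.refl ⟨*⟩ linear⁻ m y≃ ⟨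
      c * dy        ∎))
    where
    dx = proj₁ (p ⇀ q)
    dy = proj₂ (p ⇀ q)
    dx′ = proj₁ (p′ ⇀ q′)
    dy′ = proj₂ (p′ ⇀ q′)
  same-label nothing b {p} {q} {p′} {q′} (x≃ , sgn) (x′≃ , sgn′) =
    let (c , 0<c , y′≈c*y) = same-sign b sgn sgn′
    in c , 0<c , ((begin
      dx′     ≈⟨ x≈y⇒x-y≈0 (≈.sym ⟦ x′≃ ⟧) ⟩
      0ℝ      ≈⟨ ℝ-Ring.zeroʳ c ⟨
      c * 0ℝ  ≈⟨ ≈.refl ⟨*⟩ x≈y⇒x-y≈0 (≈.sym ⟦ x≃ ⟧) ⟨
      c * dx  ∎) , y′≈c*y)
    where
    dx = proj₁ (p ⇀ q)
    dx′ = proj₁ (p′ ⇀ q′)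

-- Permutations and factorials

-- A permutation of Fin n from its Lehmer code, read as a number below n !.
permute : ∀ n → Fin (n !) → Fin n → Fin n
permute (suc n) c zero    = proj₁ (remQuot {suc n} (n !) c)
permute (suc n) c (suc x) =
  punchIn (proj₁ (remQuot {suc n} (n !) c)) (permute n (proj₂ (remQuot {suc n} (n !) c)) x)

permute-injective : ∀ n c {x y} → permute n c x ≡ permute n c y → x ≡ y
permute-injective (suc n) c {zero}  {zero}  _  = refl
permute-injective (suc n) c {zero}  {suc y} eq = contradiction (sym eq) (Fin.punchInᵢ≢i _ _)
permute-injective (suc n) c {suc x} {zero}  eq = contradiction eq (Fin.punchInᵢ≢i _ _)
permute-injective (suc n) c {suc x} {suc y} eq = cong suc
  (permute-injective n _ (Fin.punchIn-injective (permute (suc n) c zero) _ _ eq))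

-- The image of `zero` is the leading digit of the code; cancelling `punchIn` at that digit leaves
-- the permutation of the remaining code. So the `n !` codes stand for `n !` different matchings.
permute-faithful : ∀ n {c d} → (∀ x → permute n c x ≡ permute n d x) → c ≡ d
permute-faithful zero    {zero} {zero} _ = refl
permute-faithful (suc n) {c} {d} eq = begin
  c                                              ≡⟨ Fin.combine-remQuot {suc n} (n !) c ⟨
  uncurry combine (remQuot {suc n} (n !) c)      ≡⟨ cong₂ combine (eq zero) (permute-faithful n λ x →
      Fin.punchIn-injective (permute (suc n) c zero) _ _
        (trans (eq (suc x)) (cong (λ i → punchIn i (permute n _ x)) (sym (eq zero))))) ⟩
  uncurry combine (remQuot {suc n} (n !) d)      ≡⟨ Fin.combine-remQuot {suc n} (n !) d ⟩
  d                                              ∎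
  where open ≡-Reasoning

^-distribʳ-* : ∀ m n k → (m ℕ.* n) ^ k ≡ m ^ k ℕ.* n ^ k
^-distribʳ-* m n zero    = refl
^-distribʳ-* m n (suc k) = trans (cong (m ℕ.* n ℕ.*_) (^-distribʳ-* m n k))
  (ℕ.[m*n]*[o*p]≡[m*o]*[n*p] m n (m ^ k) (n ^ k))

n<2^n : ∀ n → n ℕ.< 2 ^ n
n<2^n zero    = ℕ.s≤s ℕ.z≤n
n<2^n (suc n) = begin-strict
  suc n                    ≤⟨ n<2^n n ⟩
  2 ^ n                    <⟨ ℕ.m<m+n (2 ^ n) (ℕ.m^n>0 2 n) ⟩
  2 ^ n ℕ.+ 2 ^ n          ≡⟨ cong (2 ^ n ℕ.+_) (ℕ.+-identityʳ (2 ^ n)) ⟨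
  2 ^ suc n                ∎
  where open ℕ.≤-Reasoning

-- Each of the top `n` factors of the factorial is at least `m`.
m^n≤[m+n]! : ∀ m n → m ^ n ℕ.≤ (n ℕ.+ m) !
m^n≤[m+n]! m zero    = ℕ.1≤n! m
m^n≤[m+n]! m (suc n) = ℕ.*-mono-≤ (ℕ.m≤n+m m (suc n)) (m^n≤[m+n]! m n)

-- With `j = C ^ (2 C)` the surplus factor `C ^ (2 C)` of the left side equals `j`, which is below
-- `2 ^ j`; the rest, `(2 C) ^ j`, is below the factorial by the previous bound.
factorial-dominates : ∀ C .{{_ : ℕ.NonZero C}} → ∃ λ n → C ^ n ℕ.< n !
factorial-dominates C = j ℕ.+ 2 ℕ.* C , (begin-strict
  C ^ (j ℕ.+ 2 ℕ.* C)        ≡⟨ ℕ.^-distribˡ-+-* C j (2 ℕ.* C) ⟩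
  C ^ j ℕ.* j                <⟨ ℕ.*-monoʳ-< (C ^ j) {{ℕ.m^n≢0 C j}} (n<2^n j) ⟩
  C ^ j ℕ.* 2 ^ j            ≡⟨ ℕ.*-comm (C ^ j) (2 ^ j) ⟩
  2 ^ j ℕ.* C ^ j            ≡⟨ ^-distribʳ-* 2 C j ⟨
  (2 ℕ.* C) ^ j              ≤⟨ m^n≤[m+n]! (2 ℕ.* C) j ⟩
  (j ℕ.+ 2 ℕ.* C) !          ∎)
  where
  open ℕ.≤-Reasoning
  j = C ^ (2 ℕ.* C)

-- Regular supergraphs

lookup-injective : ∀ {A : Set} {xs : List A} → Unique xs → ∀ {i j} → lookup xs i ≡ lookup xs j → i ≡ j
lookup-injective (x∉ ∷ _) {zero}  {zero}  _  = refl
lookup-injective (x∉ ∷ _) {zero}  {suc j} eq = contradiction eq (All.lookup x∉ (∈-lookup j))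
lookup-injective (x∉ ∷ _) {suc i} {zero}  eq = contradiction (sym eq) (All.lookup x∉ (∈-lookup i))
lookup-injective (_ ∷ u)  {suc i} {suc j} eq = cong suc (lookup-injective u eq)

-- `degree v` is definitionally `count (v ~?_)`, so the lemmas on `count` apply to degrees without
-- conversion.
count : ∀ {n} {P : Pred (Fin n) 0ℓ} → U.Decidable P → ℕ
count {n} P? = length (filter P? (allFin n))

module _ {n} {P : Pred (Fin n) 0ℓ} (P? : U.Decidable P) where

  count-cong : ∀ {Q : Pred (Fin n) 0ℓ} (Q? : U.Decidable Q) → (∀ {i} → P i → Q i) → (∀ {i} → Q i → P i) →
               count P? ≡ count Q?
  count-cong Q? P⊆Q Q⊆P = cong length (List.filter-≐ P? Q? (P⊆Q , Q⊆P) (allFin n))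

  -- The colour may depend on the proof of `P i`: for degrees it is the kind of link that the proof
  -- of adjacency records.
  count-≤ : ∀ {d} (colour : ∀ {i} → P i → Fin d) →
            (∀ {i j} (p : P i) (q : P j) → colour p ≡ colour q → i ≡ j) → count P? ℕ.≤ d
  count-≤ colour colour-injective = Fin.injective⇒≤ λ {i} {j} eq →
    lookup-injective (filter⁺ P? (allFin⁺ n)) (colour-injective (holds i) (holds j) eq)
    where
    holds : ∀ i → P (lookup (filter P? (allFin n)) i)
    holds i = All.lookup (all-filter P? (allFin n)) (∈-lookup i)

  count-none : (∀ {i} → ¬ P i) → count P? ≡ 0
  count-none ¬P = ℕ.n≤0⇒n≡0 (count-≤ (λ p → contradiction p ¬P) (λ p → contradiction p ¬P))

  count-one : ∀ {a} → P a → (∀ {i} → P i → i ≡ a) → count P? ≡ 1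
  count-one {a} Pa unique = ℕ.≤-antisym
    (count-≤ (λ _ → zero) (λ p q _ → trans (unique p) (sym (unique q))))
    (∈-length (∈-filter⁺ P? (∈-allFin a) Pa))

module _ {A : Set} {P : Pred A 0ℓ} (P? : U.Decidable P) where

  length-filter-tabulate : ∀ {m n} (f : Fin n → A) (g : Fin m → Fin n) →
    length (filter P? (tabulate (f ∘ g))) ≡ length (filter (P? ∘ f) (tabulate g))
  length-filter-tabulate {zero}  f g = refl
  length-filter-tabulate {suc m} f g with does (P? (f (g zero)))
  ... | true  = cong suc (length-filter-tabulate f (g ∘ suc))
  ... | false = length-filter-tabulate f (g ∘ suc)

tabulate-+ : ∀ {A : Set} m {n} (f : Fin (m ℕ.+ n) → A) →
             tabulate f ≡ tabulate (f ∘ (_↑ˡ n)) ++ tabulate (f ∘ (m ↑ʳ_))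
tabulate-+ zero    f = refl
tabulate-+ (suc m) f = cong (f zero ∷_) (tabulate-+ m (f ∘ suc))

count-+ : ∀ m {n} {P : Pred (Fin (m ℕ.+ n)) 0ℓ} (P? : U.Decidable P) →
          count P? ≡ count (P? ∘ (_↑ˡ n)) ℕ.+ count (P? ∘ (m ↑ʳ_))
count-+ m {n} P? = begin
  count P?
    ≡⟨ cong (length ∘ filter P?) (tabulate-+ m id) ⟩
  length (filter P? (tabulate (_↑ˡ n) ++ tabulate (m ↑ʳ_)))
    ≡⟨ cong length (List.filter-++ P? (tabulate (_↑ˡ n)) (tabulate (m ↑ʳ_))) ⟩
  length (filter P? (tabulate (_↑ˡ n)) ++ filter P? (tabulate (m ↑ʳ_)))
    ≡⟨ List.length-++ (filter P? (tabulate (_↑ˡ n))) ⟩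
  length (filter P? (tabulate (_↑ˡ n))) ℕ.+ length (filter P? (tabulate (m ↑ʳ_)))
    ≡⟨ cong₂ ℕ._+_ (length-filter-tabulate P? (_↑ˡ n) id) (length-filter-tabulate P? (m ↑ʳ_) id) ⟩
  count (P? ∘ (_↑ˡ n)) ℕ.+ count (P? ∘ (m ↑ʳ_)) ∎
  where open ≡-Reasoning

record _↪_ (G H : Graph) : Set where
  private
    module G = Graph G
    module H = Graph H
  field
    vertex           : G.Vertex → H.Vertex
    vertex-injective : ∀ {u v} → vertex u ≡ vertex v → u ≡ v
    edge             : ∀ {u v} → u G.~ v → vertex u H.~ vertex v

↪-refl : ∀ {G} → G ↪ G
↪-refl = record { vertex = id ; vertex-injective = id ; edge = id }

↪-trans : ∀ {G H K} → G ↪ H → H ↪ K → G ↪ K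
↪-trans f g = record
  { vertex           = g.vertex ∘ f.vertex
  ; vertex-injective = f.vertex-injective ∘ g.vertex-injective
  ; edge             = g.edge ∘ f.edge
  }
  where
  module f = _↪_ f
  module g = _↪_ g

-- Joining the twins of degree less than Δ raises exactly these degrees by one, so at most Δ doublings
-- make the graph Δ-regular.
module Doubling (Δ : ℕ) (G : Graph) where
  open Graph G

  private
    n = order

    Twins : Vertex → Vertex → Set
    Twins a b = a ≡ b × degree a ℕ.< Δ

    twins? : Decidable Twins
    twins? a b = a Fin.≟ b ×-dec degree a ℕ.<? Δ

    twins-sym : ∀ {a b} → Twins a b → Twins b a
    twins-sym (refl , deficient) = refl , deficient

    Adjacent : Vertex ⊎ Vertex → Vertex ⊎ Vertex → Set
    Adjacent (inj₁ a) (inj₁ b) = a ~ b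
    Adjacent (inj₁ a) (inj₂ b) = Twins a b
    Adjacent (inj₂ a) (inj₁ b) = Twins a b
    Adjacent (inj₂ a) (inj₂ b) = a ~ b

    adjacent? : Decidable Adjacent
    adjacent? (inj₁ a) (inj₁ b) = a ~? b
    adjacent? (inj₁ a) (inj₂ b) = twins? a b
    adjacent? (inj₂ a) (inj₁ b) = twins? a b
    adjacent? (inj₂ a) (inj₂ b) = a ~? b

    adjacent-sym : ∀ x y → Adjacent x y → Adjacent y x
    adjacent-sym (inj₁ a) (inj₁ b) = ~-sym
    adjacent-sym (inj₁ a) (inj₂ b) = twins-sym
    adjacent-sym (inj₂ a) (inj₁ b) = twins-sym
    adjacent-sym (inj₂ a) (inj₂ b) = ~-sym

    adjacent-irrefl : ∀ x → ¬ Adjacent x x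
    adjacent-irrefl (inj₁ a) = ~-irrefl refl
    adjacent-irrefl (inj₂ a) = ~-irrefl refl

  double : Graph
  double = record
    { order    = n ℕ.+ n
    ; _~_      = λ i j → Adjacent (splitAt n i) (splitAt n j)
    ; _~?_     = λ i j → adjacent? (splitAt n i) (splitAt n j)
    ; ~-sym    = λ {i} {j} → adjacent-sym (splitAt n i) (splitAt n j)
    ; ~-irrefl = λ { {i} refl → adjacent-irrefl (splitAt n i) }
    }

  private
    module D = Graph double

    count-split : ∀ x {P Q : Pred Vertex 0ℓ} (P? : U.Decidable P) (Q? : U.Decidable Q) →
      (∀ b → Adjacent x (inj₁ b) ≡ P b) → (∀ b → Adjacent x (inj₂ b) ≡ Q b) →
      count (λ j → adjacent? x (splitAt n j)) ≡ count P? ℕ.+ count Q?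
    count-split x P? Q? ≡P ≡Q = trans (count-+ n (λ j → adjacent? x (splitAt n j))) (cong₂ ℕ._+_
      (count-cong _ P? (λ {b} → subst id (trans (cong (Adjacent x) (Fin.splitAt-↑ˡ n b n)) (≡P b)))
                       (λ {b} → subst id (sym (trans (cong (Adjacent x) (Fin.splitAt-↑ˡ n b n)) (≡P b)))))
      (count-cong _ Q? (λ {b} → subst id (trans (cong (Adjacent x) (Fin.splitAt-↑ʳ n n b)) (≡Q b)))
                       (λ {b} → subst id (sym (trans (cong (Adjacent x) (Fin.splitAt-↑ʳ n n b)) (≡Q b))))))

  original : Fin (n ℕ.+ n) → Vertex
  original i = [ id , id ]′ (splitAt n i)

  degree-double : ∀ i → D.degree i ≡ degree (original i) ℕ.+ count (twins? (original i))
  degree-double i with splitAt n i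
  ... | inj₁ a = count-split (inj₁ a) (a ~?_) (twins? a) (λ _ → refl) (λ _ → refl)
  ... | inj₂ a = trans (count-split (inj₂ a) (twins? a) (a ~?_) (λ _ → refl) (λ _ → refl))
                       (ℕ.+-comm (count (twins? a)) (degree a))

  degree-deficient : ∀ i → degree (original i) ℕ.< Δ → D.degree i ≡ suc (degree (original i))
  degree-deficient i deficient = trans (degree-double i) (trans
    (cong (degree (original i) ℕ.+_) (count-one (twins? (original i)) (refl , deficient) (sym ∘ proj₁)))
    (ℕ.+-comm _ 1))

  degree-full : ∀ i → ¬ degree (original i) ℕ.< Δ → D.degree i ≡ degree (original i)
  degree-full i full = trans (degree-double i) (trans
    (cong (degree (original i) ℕ.+_) (count-none (twins? (original i)) (full ∘ proj₂)))
    (ℕ.+-identityʳ _))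

  double-↪ : G ↪ double
  double-↪ = record
    { vertex           = _↑ˡ n
    ; vertex-injective = Fin.↑ˡ-injective n _ _
    ; edge             = λ {u} {v} → subst₂ Adjacent (sym (Fin.splitAt-↑ˡ n u n)) (sym (Fin.splitAt-↑ˡ n v n))
    }

-- Induction on a bound `j` for the deficiency `Δ - degree` of all vertices. A doubling lowers every
-- positive deficiency by one and leaves full vertices alone.
regularise : ∀ {Δ} j G → (∀ v → Graph.degree G v ℕ.≤ Δ) → (∀ v → Δ ℕ.≤ j ℕ.+ Graph.degree G v) →
             ∃ λ H → Regular Δ H × G ↪ H
regularise zero    G ≤Δ Δ≤ = G , (λ v → ℕ.≤-antisym (≤Δ v) (Δ≤ v)) , ↪-refl
regularise {Δ} (suc j) G ≤Δ Δ≤ =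
  let (H , H-regular , G²↪H) = regularise j double ≤Δ² Δ≤²
  in H , H-regular , ↪-trans double-↪ G²↪H
  where
  open Doubling Δ G
  ≤Δ² : ∀ i → Graph.degree double i ℕ.≤ Δ
  ≤Δ² i with Graph.degree G (original i) ℕ.<? Δ
  ... | yes deficient = subst (ℕ._≤ Δ) (sym (degree-deficient i deficient)) deficient
  ... | no  full      = subst (ℕ._≤ Δ) (sym (degree-full i full)) (≤Δ (original i))
  Δ≤² : ∀ i → Δ ℕ.≤ j ℕ.+ Graph.degree double i
  Δ≤² i with Graph.degree G (original i) ℕ.<? Δ
  ... | yes deficient = subst (λ d → Δ ℕ.≤ j ℕ.+ d) (sym (degree-deficient i deficient))
                          (subst (Δ ℕ.≤_) (sym (ℕ.+-suc j _)) (Δ≤ (original i)))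
  ... | no  full      = subst (λ d → Δ ℕ.≤ j ℕ.+ d) (sym (degree-full i full))
                          (ℕ.≤-trans (ℕ.≮⇒≥ full) (ℕ.m≤n+m _ j))

-- Drawings on a parabola

cancel-product : ∀ {p q r} → (p ℚ.- q) ℚ.* r ≡ 0ℚ → p ≡ q ⊎ r ≡ 0ℚ
cancel-product {p} {q} {r} eq with p ℚ.≟ q
... | yes p≡q = inj₁ p≡q
... | no  p≢q = inj₂ (begin
  r                          ≡⟨ ℚ.*-identityˡ r ⟨
  1ℚ ℚ.* r                   ≡⟨ cong (ℚ._* r) (ℚ.*-inverseˡ (p ℚ.- q)) ⟨
  d⁻¹ ℚ.* (p ℚ.- q) ℚ.* r    ≡⟨ ℚ.*-assoc d⁻¹ (p ℚ.- q) r ⟩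
  d⁻¹ ℚ.* ((p ℚ.- q) ℚ.* r)  ≡⟨ cong (d⁻¹ ℚ.*_) eq ⟩
  d⁻¹ ℚ.* 0ℚ                 ≡⟨ ℚ.*-zeroʳ d⁻¹ ⟩
  0ℚ                         ∎)
  where
  open ≡-Reasoning
  instance
    p-q≢0 : ℚ.NonZero (p ℚ.- q)
    p-q≢0 = ℚ.≢-nonZero (p≢q ∘ ℚ-Group.x∙y⁻¹≈ε⇒x≈y p q)
  d⁻¹ = ℚ.1/ (p ℚ.- q)

fromℕ : ℕ → ℚ
fromℕ zero    = 0ℚ
fromℕ (suc n) = 1ℚ ℚ.+ fromℕ n

0≤fromℕ : ∀ n → 0ℚ ℚ.≤ fromℕ n
0≤fromℕ zero    = ℚ.≤-refl
0≤fromℕ (suc n) = ℚ.+-mono-≤ (ℚ.<⇒≤ (ℚ.positive⁻¹ 1ℚ)) (0≤fromℕ n)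

0<fromℕ-suc : ∀ n → 0ℚ ℚ.< fromℕ (suc n)
0<fromℕ-suc n = ℚ.+-mono-<-≤ (ℚ.positive⁻¹ 1ℚ) (0≤fromℕ n)

fromℕ-injective : ∀ {m n} → fromℕ m ≡ fromℕ n → m ≡ n
fromℕ-injective {zero}  {zero}  _  = refl
fromℕ-injective {zero}  {suc n} eq = contradiction eq (ℚ.<⇒≢ (0<fromℕ-suc n))
fromℕ-injective {suc m} {zero}  eq = contradiction (sym eq) (ℚ.<⇒≢ (0<fromℕ-suc m))
fromℕ-injective {suc m} {suc n} eq = cong suc (fromℕ-injective (ℚ-Group.∙-cancelˡ 1ℚ _ _ eq))

fromℕ-+ : ∀ m n → fromℕ (m ℕ.+ n) ≡ fromℕ m ℚ.+ fromℕ n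
fromℕ-+ zero    n = sym (ℚ.+-identityˡ (fromℕ n))
fromℕ-+ (suc m) n = trans (cong (1ℚ ℚ.+_) (fromℕ-+ m n)) (sym (ℚ.+-assoc 1ℚ (fromℕ m) (fromℕ n)))

parabola : ℚ → Point
parabola q = fromℚ q , fromℚ (q ℚ.* q)

fromℚ-minus : ∀ p q → fromℚ p - fromℚ q ≈ fromℚ (p ℚ.- q)
fromℚ-minus p q = ≈.sym (≈.trans (fromℚ-+ p (ℚ.- q)) (≈.refl ⟨+⟩ fromℚ-neg q))

-- A line meets the parabola at most twice. The coordinates give `c - a = t (b - a)` and
-- `c² - a² = t (b² - a²)`, hence `c² - a² = (c - a) (b + a)`, which rearranges to
-- `(c - a) (c - b) = 0`.
parabola-strictly-convex : ∀ {a b c} → OnSegment (parabola a) (parabola b) (parabola c) → c ≡ a ⊎ c ≡ b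
parabola-strictly-convex {a} {b} {c} c∈ab = let (t , _ , _ , x≈ , y≈) = segment⁻ c∈ab in
  Sum.map₂ (ℚ-Group.x∙y⁻¹≈ε⇒x≈y c b) (cancel-product {c} {a} (fromℚ-injective (begin
    fromℚ ((c ℚ.- a) ℚ.* (c ℚ.- b))
      ≈⟨ fromℚ-* (c ℚ.- a) (c ℚ.- b) ⟩
    fromℚ (c ℚ.- a) * fromℚ (c ℚ.- b)
      ≈⟨ fromℚ-minus c a ⟨*⟩ fromℚ-minus c b ⟨
    (fromℚ c - fromℚ a) * (fromℚ c - fromℚ b)
      ≈⟨ solve 3 (λ a b c →
          (c :- a) :* (c :- b) := (c :* c :- a :* a) :- (c :- a) :* (b :+ a)) ≈.refl (fromℚ a) (fromℚ b) (fromℚ c) ⟩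
    (fromℚ c * fromℚ c - fromℚ a * fromℚ a) - (fromℚ c - fromℚ a) * (fromℚ b + fromℚ a)
      ≈⟨ ((fromℚ-* c c ⟨-⟩ fromℚ-* a a) ⟨-⟩ ≈.refl) ⟨
    (fromℚ (c ℚ.* c) - fromℚ (a ℚ.* a)) - (fromℚ c - fromℚ a) * (fromℚ b + fromℚ a)
      ≈⟨ y≈ ⟨-⟩ (x≈ ⟨*⟩ ≈.refl) ⟩
    t * (fromℚ (b ℚ.* b) - fromℚ (a ℚ.* a)) - t * (fromℚ b - fromℚ a) * (fromℚ b + fromℚ a)
      ≈⟨ (≈.refl ⟨*⟩ (fromℚ-* b b ⟨-⟩ fromℚ-* a a)) ⟨-⟩ ≈.refl ⟩
    t * (fromℚ b * fromℚ b - fromℚ a * fromℚ a) - t * (fromℚ b - fromℚ a) * (fromℚ b + fromℚ a)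
      ≈⟨ solve 3 (λ a b t →
          t :* (b :* b :- a :* a) :- t :* (b :- a) :* (b :+ a) := con 0ℚ) ≈.refl (fromℚ a) (fromℚ b) t ⟩
    fromℚ 0ℚ ∎)))
  where
  open ≈-Reasoning
  open ℝ-Solver using (solve; _:+_; _:-_; _:*_; :-_; _:=_; con)

parabola-slope : ∀ {a b} → ¬ a ≡ b → HasSlope (parabola a) (parabola b) (just (fromℚ (a ℚ.+ b)))
parabola-slope {a} {b} a≢b = (λ a≃b → a≢b (fromℚ-injective ⟦ a≃b ⟧)) , ≗⇒≃
  {fromℚ (b ℚ.* b) -ᴿ fromℚ (a ℚ.* a)} {fromℚ (a ℚ.+ b) *ᴿ (fromℚ b -ᴿ fromℚ a)} (λ _ →
    solve 2 (λ a b → b :* b :- a :* a := (a :+ b) :* (b :- a)) refl a b)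
  where open +-*-Solver using (solve; _:+_; _:-_; _:*_; _:=_)

module _ (G : Graph) where
  open Graph G

  private
    at : Vertex → ℚ
    at v = fromℕ (toℕ v)

    at-injective : ∀ {u v} → at u ≡ at v → u ≡ v
    at-injective = Fin.toℕ-injective ∘ fromℕ-injective

  -- Some drawing with an exact slope count is needed for a slope-number to exist, although equality
  -- of real slopes is undecidable. Here the slope of an edge is the sum of its two vertex indices,
  -- so the slopes can be listed without repetition by deciding which numbers are such sums.
  parabola-drawing : GeometricDrawing G
  parabola-drawing = record
    { pos          = parabola ∘ at
    ; pos-distinct = λ (x≃ , _) → at-injective (fromℚ-injective ⟦ x≃ ⟧)
    ; edge-avoids  = λ _ w∈uv → Sum.map at-injective at-injective (parabola-strictly-convex w∈uv)
    }

  private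
    EdgeSum : ℕ → Set
    EdgeSum s = ∃₂ λ u v → u ~ v × toℕ u ℕ.+ toℕ v ≡ s

    edgeSum? : ∀ s → Dec (EdgeSum s)
    edgeSum? s = Fin.any? λ u → Fin.any? λ v → (u ~? v) ×-dec (toℕ u ℕ.+ toℕ v ℕ.≟ s)

    sums : List ℕ
    sums = filter edgeSum? (upTo (order ℕ.+ order))

    slope : ∀ {u v s} → u ~ v → toℕ u ℕ.+ toℕ v ≡ s →
            HasSlope (parabola (at u)) (parabola (at v)) (just (fromℚ (fromℕ s)))
    slope {u} {v} u~v refl = subst
      (λ q → HasSlope (parabola (at u)) (parabola (at v)) (just (fromℚ q)))
      (sym (fromℕ-+ (toℕ u) (toℕ v)))
      (parabola-slope λ eq → ~-irrefl (at-injective eq) u~v)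

    edgeSum∈ : ∀ {u v} → u ~ v → toℕ u ℕ.+ toℕ v ∈ sums
    edgeSum∈ {u} {v} u~v = ∈-filter⁺ edgeSum?
      (∈-upTo⁺ (ℕ.+-mono-< (Fin.toℕ<n u) (Fin.toℕ<n v))) (u , v , u~v , refl)

  parabola-slopeCount : HasSlopeCount G parabola-drawing (length sums)
  parabola-slopeCount
    = (λ i → just (fromℚ (fromℕ (lookup sums i))))
    , (λ { (just eq) → lookup-injective (filter⁺ edgeSum? (upTo⁺ (order ℕ.+ order)))
                        (fromℕ-injective (fromℚ-injective ⟦ eq ⟧)) })
    , (λ i → let (u , v , u~v , eq) = All.lookup (all-filter edgeSum? (upTo (order ℕ.+ order))) (∈-lookup i)
             in u , v , u~v , slope u~v eq)
    , (λ u~v → index (edgeSum∈ u~v) , slope u~v (lookup-index (edgeSum∈ u~v)))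

-- As `P` need not be decidable, no search is possible. Instead, if there is no least witness,
-- induction on `b` shows that `P` fails at every number up to `b`.
least : ∀ {P : ℕ → Set} n → P n → ¬ ¬ (∃ λ m → P m × (∀ k → P k → m ℕ.≤ k))
least {P} n Pn ¬least = none n n ℕ.≤-refl Pn
  where
  none : ∀ b m → m ℕ.≤ b → ¬ P m
  none zero    m m≤0 Pm = ¬least (m , Pm , λ k _ → ℕ.≤-trans m≤0 ℕ.z≤n)
  none (suc b) m m≤1+b Pm = ¬least (m , Pm , λ k Pk → ℕ.≮⇒≥ λ k<m →
    none b k (ℕ.s≤s⁻¹ (ℕ.≤-trans k<m m≤1+b)) Pk)

slopeNumber-exists : ∀ G → ¬ ¬ (∃ (IsSlopeNumber G))
slopeNumber-exists G k = least {λ s → ∃ λ D → HasSlopeCount G D s} _ (parabola-drawing G , parabola-slopeCount G)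
  λ (s , attained , minimal) → k (s , attained , λ D t count → minimal t (D , count))

-- Paths with matchings

module _ where
  open ≈-Reasoning
  open ℝ-Solver using (solve; _:+_; _:-_; _:*_; _:=_)

  ≋-ratio : ∀ {r s u v} → r ≈ s → v ≋ s · u → v ≋ r · u
  ≋-ratio r≈s (x≈ , y≈) = ≈.trans x≈ (≈.sym r≈s ⟨*⟩ ≈.refl) , ≈.trans y≈ (≈.sym r≈s ⟨*⟩ ≈.refl)

  ⇀-trans : ∀ {r a b c a′ b′ c′} → a′ ⇀ b′ ≋ r · a ⇀ b → b′ ⇀ c′ ≋ r · b ⇀ c → a′ ⇀ c′ ≋ r · a ⇀ c
  ⇀-trans {r} (ab₁ , ab₂) (bc₁ , bc₂) = add ab₁ bc₁ , add ab₂ bc₂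
    where
    add : ∀ {x y z x′ y′ z′} → y′ - x′ ≈ r * (y - x) → z′ - y′ ≈ r * (z - y) → z′ - x′ ≈ r * (z - x)
    add {x} {y} {z} {x′} {y′} {z′} xy yz = begin
      z′ - x′                    ≈⟨ solve 3 (λ x y z → z :- x := (y :- x) :+ (z :- y)) ≈.refl x′ y′ z′ ⟩
      (y′ - x′) + (z′ - y′)      ≈⟨ xy ⟨+⟩ yz ⟩
      r * (y - x) + r * (z - y)
        ≈⟨ solve 4 (λ r x y z → r :* (y :- x) :+ r :* (z :- y) := r :* (z :- x)) ≈.refl r x y z ⟩
      r * (z - x)                ∎

  ⇀-sym : ∀ {r a b a′ b′} → a′ ⇀ b′ ≋ r · a ⇀ b → b′ ⇀ a′ ≋ r · b ⇀ a
  ⇀-sym {r} (ab₁ , ab₂) = negate ab₁ , negate ab₂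
    where
    negate : ∀ {x y x′ y′} → y′ - x′ ≈ r * (y - x) → x′ - y′ ≈ r * (x - y)
    negate {x} {y} {x′} {y′} xy = begin
      x′ - y′        ≈⟨ solve 2 (λ x y → x :- y := (y :- y) :- (y :- x)) ≈.refl x′ y′ ⟩
      (y′ - y′) - (y′ - x′)  ≈⟨ ≈.refl ⟨-⟩ xy ⟩
      (y′ - y′) - r * (y - x)
        ≈⟨ solve 4 (λ r x y z → (z :- z) :- r :* (y :- x) := r :* (x :- y)) ≈.refl r x y y′ ⟩
      r * (x - y)    ∎

Homothetic : Point → Point → Point → Point → Set
Homothetic a b a′ b′ = ∃ λ r → Pos r × a′ ⇀ b′ ≋ r · a ⇀ b

-- A priori each link has its own ratio between the two drawings. Triangles on three consecutive
-- vertices overlap in a path edge, and `rigid-triangle` passes the ratio of one path edge to the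
-- next, so the ratio of the first edge is the ratio of all.
module Frame {N} (1<N : 1 ℕ.< N) (p q : Fin N → Point)
  (distinct : ∀ {i j} → p i ≈ₚ p j → i ≡ j)
  (nondegenerate : ∀ {i j k} → toℕ j ≡ 1 ℕ.+ toℕ i → toℕ k ≡ 1 ℕ.+ toℕ j →
    ∀ {r} → ¬ p i ⇀ p k ≋ r · p i ⇀ p j)
  (step₁ : ∀ {i j} → toℕ j ≡ 1 ℕ.+ toℕ i → Homothetic (p i) (p j) (q i) (q j))
  (step₂ : ∀ {i j} → toℕ j ≡ 2 ℕ.+ toℕ i → Homothetic (p i) (p j) (q i) (q j))
  where

  private
    at : ∀ m → .(m ℕ.< N) → Fin N
    at m m<N = fromℕ< m<N

    at-+ : ∀ d m → .(d+m<N : d ℕ.+ m ℕ.< N) .(m<N : m ℕ.< N) → toℕ (at (d ℕ.+ m) d+m<N) ≡ d ℕ.+ toℕ (at m m<N)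
    at-+ d m d+m<N m<N = trans (Fin.toℕ-fromℕ< d+m<N) (cong (d ℕ.+_) (sym (Fin.toℕ-fromℕ< m<N)))

    0<N : 0 ℕ.< N
    0<N = ℕ.<-trans ℕ.z<s 1<N

  first : Homothetic (p (at 0 0<N)) (p (at 1 1<N)) (q (at 0 0<N)) (q (at 1 1<N))
  first = step₁ (at-+ 1 0 1<N 0<N)

  ratio : ℝ
  ratio = proj₁ first

  ratio>0 : Pos ratio
  ratio>0 = proj₁ (proj₂ first)

  private
    consecutive : ∀ m (m+1<N : suc m ℕ.< N) (m<N : m ℕ.< N) →
      q (at m m<N) ⇀ q (at (suc m) m+1<N) ≋ ratio · p (at m m<N) ⇀ p (at (suc m) m+1<N)
    consecutive zero    1<N   0<N   = proj₂ (proj₂ first)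
    consecutive (suc m) m+2<N m+1<N =
      let m<N         = ℕ.<-trans (ℕ.n<1+n m) m+1<N
          ij          = at-+ 1 m m+1<N m<N
          jk          = at-+ 1 (suc m) m+2<N m+1<N
          (_ , _ , s) = step₂ (at-+ 2 m m+2<N m<N)
          (_ , _ , t) = step₁ jk
          i≉j         = λ i≈j → ℕ.1+n≢n (trans (sym ij) (cong toℕ (sym (distinct i≈j))))
      in ≋-ratio (rigid-triangle (nondegenerate ij jk) i≉j (consecutive m m+1<N m<N) s t) t

    from-zero : ∀ m (m<N : m ℕ.< N) →
      q (at 0 0<N) ⇀ q (at m m<N) ≋ ratio · p (at 0 0<N) ⇀ p (at m m<N)
    -- The zero vector is obtained as the first edge followed by its reverse.
    from-zero zero    _     = ⇀-trans (consecutive 0 1<N 0<N) (⇀-sym (consecutive 0 1<N 0<N))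
    from-zero (suc m) m+1<N = let m<N = ℕ.<-trans (ℕ.n<1+n m) m+1<N in
      ⇀-trans (from-zero m m<N) (consecutive m m+1<N m<N)

  homothety : ∀ i j → q i ⇀ q j ≋ ratio · p i ⇀ p j
  homothety i j = ⇀-trans (⇀-sym (to i)) (to j)
    where
    to : ∀ i → q (at 0 0<N) ⇀ q i ≋ ratio · p (at 0 0<N) ⇀ p i
    to i = subst (λ i → q (at 0 0<N) ⇀ q i ≋ ratio · p (at 0 0<N) ⇀ p i) (Fin.fromℕ<-toℕ i (Fin.toℕ<n i))
      (from-zero (toℕ i) (Fin.toℕ<n i))

-- Matchings between the two halves of a path, and the number of them that few slopes allow

Matched : ∀ {n} → (Fin n → Fin n) → Fin n ⊎ Fin n → Fin n ⊎ Fin n → Set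
Matched f (inj₁ a) (inj₂ b) = f a ≡ b
Matched f (inj₂ b) (inj₁ a) = f a ≡ b
Matched f (inj₁ _) (inj₁ _) = ⊥
Matched f (inj₂ _) (inj₂ _) = ⊥

matched? : ∀ {n} (f : Fin n → Fin n) → Decidable (Matched f)
matched? f (inj₁ a) (inj₂ b) = f a Fin.≟ b
matched? f (inj₂ b) (inj₁ a) = f a Fin.≟ b
matched? f (inj₁ _) (inj₁ _) = no id
matched? f (inj₂ _) (inj₂ _) = no id

matched-sym : ∀ {n} (f : Fin n → Fin n) x y → Matched f x y → Matched f y x
matched-sym f (inj₁ _) (inj₂ _) = id
matched-sym f (inj₂ _) (inj₁ _) = id

matched-irrefl : ∀ {n} (f : Fin n → Fin n) x → ¬ Matched f x x
matched-irrefl f (inj₁ _) ()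
matched-irrefl f (inj₂ _) ()

matched-functional : ∀ {n} {f : Fin n → Fin n} → (∀ {a b} → f a ≡ f b → a ≡ b) →
                     ∀ x {y z} → Matched f x y → Matched f x z → y ≡ z
matched-functional f-injective (inj₁ a) {inj₂ _} {inj₂ _} xy xz = cong inj₂ (trans (sym xy) xz)
matched-functional f-injective (inj₂ b) {inj₁ _} {inj₁ _} xy xz = cong inj₁ (f-injective (trans xy (sym xz)))

-- Double negation shift, valid over a finite index set. It allows labels for all links to be fixed
-- simultaneously before they are encoded.
¬¬-∀ : ∀ {n} {A : Fin n → Set} → (∀ i → ¬ ¬ A i) → ¬ ¬ (∀ i → A i)
¬¬-∀ {zero}  ¬¬A k = k λ ()
¬¬-∀ {suc n} ¬¬A k = ¬¬A zero λ a → ¬¬-∀ (¬¬A ∘ suc) λ as → k (Fin.∀-cons a as)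

module FramesWithMatchings (n : ℕ) where

  -- Every kind of link is a partial function of its source: this bounds the degree by 5.
  Link : Fin (n !) → Fin 5 → Fin (n ℕ.+ n) → Fin (n ℕ.+ n) → Set
  Link c 0F i j = toℕ j ≡ 1 ℕ.+ toℕ i
  Link c 1F i j = toℕ i ≡ 1 ℕ.+ toℕ j
  Link c 2F i j = toℕ j ≡ 2 ℕ.+ toℕ i
  Link c 3F i j = toℕ i ≡ 2 ℕ.+ toℕ j
  Link c 4F i j = Matched (permute n c) (splitAt n i) (splitAt n j)

  link? : ∀ c r → Decidable (Link c r)
  link? c 0F i j = toℕ j ℕ.≟ 1 ℕ.+ toℕ i
  link? c 1F i j = toℕ i ℕ.≟ 1 ℕ.+ toℕ j
  link? c 2F i j = toℕ j ℕ.≟ 2 ℕ.+ toℕ i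
  link? c 3F i j = toℕ i ℕ.≟ 2 ℕ.+ toℕ j
  link? c 4F i j = matched? (permute n c) (splitAt n i) (splitAt n j)

  link-sym : ∀ c r {i j} → Link c r i j → ∃ λ r′ → Link c r′ j i
  link-sym c 0F l = 1F , l
  link-sym c 1F l = 0F , l
  link-sym c 2F l = 3F , l
  link-sym c 3F l = 2F , l
  link-sym c 4F {i} {j} l = 4F , matched-sym (permute n c) (splitAt n i) (splitAt n j) l

  link-irrefl : ∀ c r {i} → ¬ Link c r i i
  link-irrefl c 0F l = ℕ.1+n≢n (sym l)
  link-irrefl c 1F l = ℕ.1+n≢n (sym l)
  link-irrefl c 2F {i} l = ℕ.m≢1+n+m (toℕ i) {1} l
  link-irrefl c 3F {i} l = ℕ.m≢1+n+m (toℕ i) {1} l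
  link-irrefl c 4F {i} l = matched-irrefl (permute n c) (splitAt n i) l

  link-functional : ∀ c r {i j k} → Link c r i j → Link c r i k → j ≡ k
  link-functional c 0F ij ik = Fin.toℕ-injective (trans ij (sym ik))
  link-functional c 1F ij ik = Fin.toℕ-injective (ℕ.suc-injective (trans (sym ij) ik))
  link-functional c 2F ij ik = Fin.toℕ-injective (trans ij (sym ik))
  link-functional c 3F ij ik = Fin.toℕ-injective (ℕ.suc-injective (ℕ.suc-injective (trans (sym ij) ik)))
  link-functional c 4F {i} {j} {k} ij ik = begin
    j                              ≡⟨ Fin.join-splitAt n n j ⟨
    Fin.join n n (splitAt n j)
      ≡⟨ cong (Fin.join n n) (matched-functional (permute-injective n c) (splitAt n i) ij ik) ⟩
    Fin.join n n (splitAt n k)     ≡⟨ Fin.join-splitAt n n k ⟩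
    k                              ∎
    where open ≡-Reasoning

  partners : ∀ c a → Link c 4F (a ↑ˡ n) (n ↑ʳ permute n c a)
  partners c a = subst₂ (Matched (permute n c))
    (sym (Fin.splitAt-↑ˡ n a n)) (sym (Fin.splitAt-↑ʳ n n (permute n c a))) refl

  private
    -- A vertex of the union is a pair: the Lehmer code of the matching on its component, and its
    -- position on the path of that component.
    code : Fin (n ! ℕ.* (n ℕ.+ n)) → Fin (n !)
    code u = proj₁ (remQuot (n ℕ.+ n) u)

    place : Fin (n ! ℕ.* (n ℕ.+ n)) → Fin (n ℕ.+ n)
    place u = proj₂ (remQuot {n !} (n ℕ.+ n) u)

    code-place-injective : ∀ {u v} → code u ≡ code v → place u ≡ place v → u ≡ v
    code-place-injective {u} {v} c≡ i≡ = begin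
      u                          ≡⟨ Fin.combine-remQuot {n !} (n ℕ.+ n) u ⟨
      combine (code u) (place u) ≡⟨ cong₂ combine c≡ i≡ ⟩
      combine (code v) (place v) ≡⟨ Fin.combine-remQuot {n !} (n ℕ.+ n) v ⟩
      v                          ∎
      where open ≡-Reasoning

    Edge : Fin 5 → Fin (n ! ℕ.* (n ℕ.+ n)) → Fin (n ! ℕ.* (n ℕ.+ n)) → Set
    Edge r u v = code u ≡ code v × Link (code u) r (place u) (place v)

    edge-sym : ∀ {u v} → ∃ (λ r → Edge r u v) → ∃ λ r → Edge r v u
    edge-sym {u} {v} (r , c≡ , l) =
      let (r′ , l′) = link-sym (code u) r l
      in r′ , sym c≡ , subst (λ c → Link c r′ (place v) (place u)) c≡ l′

  frames-with-matchings : Graph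
  frames-with-matchings = record
    { order    = n ! ℕ.* (n ℕ.+ n)
    ; _~_      = λ u v → ∃ λ r → Edge r u v
    ; _~?_     = λ u v → Fin.any? λ r → (code u Fin.≟ code v) ×-dec link? (code u) r (place u) (place v)
    ; ~-sym    = edge-sym
    ; ~-irrefl = λ { refl (r , _ , l) → link-irrefl _ r l }
    }

  open Graph frames-with-matchings using (degree; _~_; _~?_)

  degree≤5 : ∀ v → degree v ℕ.≤ 5
  degree≤5 v = count-≤ (v ~?_) proj₁ λ { (r , cᵢ≡ , lᵢ) (_ , cⱼ≡ , lⱼ) refl →
    code-place-injective (trans (sym cᵢ≡) cⱼ≡) (link-functional (code v) r lᵢ lⱼ) }

  link⇒~ : ∀ {c r i j} → Link c r i j → combine c i ~ combine c j
  link⇒~ {c} {r} {i} {j} l =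
    r , trans (cong proj₁ ci) (sym (cong proj₁ cj)) ,
    subst₂ (λ (c , i) (_ , j) → Link c r i j) (sym ci) (sym cj) l
    where
    ci = Fin.remQuot-combine c i
    cj = Fin.remQuot-combine c j

  -- `P c` is the part of one drawing that shows the component with matching code `c`. All parts
  -- share the list `σ`, so equal labels in different parts mean equal directions.
  module FewSlopes {t : ℕ} (P : Fin (n !) → Fin (n ℕ.+ n) → Point)
    (distinct : ∀ {c i j} → P c i ≈ₚ P c j → i ≡ j)
    (avoids : ∀ {c r i j k} → Link c r i j → OnSegment (P c i) (P c j) (P c k) → k ≡ i ⊎ k ≡ j)
    (σ : Fin t → Slope)
    (slope : ∀ {c r i j} → Link c r i j → ∃ λ s → HasSlope (P c i) (P c j) (σ s))
    (k : ℕ) (t≤1+k : t ℕ.≤ suc k)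
    where

    -- The factor 2 accounts for the sign. Using `suc k` keeps `K` positive even for `k = 0`, so
    -- that a default label exists and the factorial bound has a nonzero base.
    K : ℕ
    K = suc k ℕ.* 2

    -- Slope indices are compared through `toℕ` because `σ` is indexed by `Fin t`, while the slope
    -- part of a label lies in `Fin (suc k)`, independent of the drawing.
    Label : Fin K → Point → Point → Set
    Label l p q = ∃ λ s →
      toℕ s ≡ toℕ (proj₁ (remQuot {suc k} 2 l)) × Labelled (σ s) (proj₂ (remQuot {suc k} 2 l)) p q

    Label⇒homothetic : ∀ l {p q p′ q′} → Label l p q → Label l p′ q′ → Homothetic p q p′ q′
    Label⇒homothetic l {p} {q} {p′} {q′} (s , s≡ , lab) (s′ , s′≡ , lab′) =
      same-label (σ s) b {p} {q} {p′} {q′} lab (subst (λ s → Labelled (σ s) b p′ q′) (Fin.toℕ-injective (trans s′≡ (sym s≡))) lab′)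
      where b = proj₂ (remQuot {suc k} 2 l)

    Labels : ∀ c i r → Fin K → Set
    Labels c i r l = ∀ {j} → Link c r i j → Label l (P c i) (P c j)

    label-exists : ∀ c i r → ¬ ¬ (∃ (Labels c i r))
    label-exists c i r k′ = choose (Fin.any? (link? c r i))
      where
      choose : Dec (∃ λ j → Link c r i j) → ⊥
      -- Without a link of this kind at `i` the requirement is vacuous, and an arbitrary label
      -- serves as default.
      choose (no  ∄j) = k′ (combine {suc k} {2} zero zero , λ l → contradiction (_ , l) ∄j)
      choose (yes (j , lᵢⱼ)) =
        let (s , hs) = slope {r = r} lᵢⱼ
            s′       = inject≤ s t≤1+k
            i≉j      = λ i≈j → link-irrefl c r (subst (Link c r i) (sym (distinct i≈j)) lᵢⱼ)
        in labelled (σ s) hs i≉j λ (b , lab) →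
          k′ (combine s′ b , λ lᵢⱼ′ → s ,
            trans (sym (Fin.toℕ-inject≤ s t≤1+k)) (cong (toℕ ∘ proj₁) (sym (Fin.remQuot-combine s′ b))) ,
            subst₂ (λ b j → Labelled (σ s) b (P c i) (P c j))
              (cong proj₂ (sym (Fin.remQuot-combine s′ b))) (link-functional c r lᵢⱼ lᵢⱼ′) lab)

    module _ {c d}
      (same : ∀ {r i j j′} → Link c r i j → Link d r i j′ → Homothetic (P c i) (P c j) (P d i) (P d j′))
      where

      nondegenerate : ∀ {i j k} → toℕ j ≡ 1 ℕ.+ toℕ i → toℕ k ≡ 1 ℕ.+ toℕ j →
        ∀ {r} → ¬ P c i ⇀ P c k ≋ r · P c i ⇀ P c j
      nondegenerate {i} {j} {k} ij jk = noncollinear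
        ([ ≢ 2F ik ∘ sym , ≢ 0F jk ∘ sym ]′ ∘ avoids {r = 0F} ij)
        ([ ≢ 0F ij ∘ sym , ≢ 0F jk ]′ ∘ avoids {r = 2F} ik)
        -- At kind `1F` the same equation `ij` is read as the link from `j` back to `i`.
        ([ ≢ 0F jk ∘ sym , ≢ 2F ik ∘ sym ]′ ∘ avoids {r = 1F} ij)
        ([ ≢ 0F ij , ≢ 2F ik ]′ ∘ avoids {r = 0F} jk)
        where
        ik : toℕ k ≡ 2 ℕ.+ toℕ i
        ik = trans jk (cong suc ij)
        ≢ : ∀ r {i j} → Link c r i j → ¬ i ≡ j
        ≢ r l refl = link-irrefl c r l

      -- If the partners differed, `same-ray` would put the partner under `d` on the matching edge
      -- in `P c`, or the partner under `c` on the matching edge in `P d`. Both contradict edge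
      -- avoidance, and decidability of equality in `Fin n` removes the double negation.
      same-partners : ∀ a → permute n c a ≡ permute n d a
      same-partners a = decidable-stable (permute n c a Fin.≟ permute n d a) λ partners≢ →
        let (r , r>0 , eq) = same (partners c a) (partners d a)
        in same-ray ratio>0 r>0 (homothety _ _) (homothety _ _) eq
          [ [ ≢-self d ∘ sym , partners≢ ∘ sym ∘ Fin.↑ʳ-injective n _ _ ]′ ∘ avoids {c} {4F} (partners c a)
          , [ ≢-self c ∘ sym , partners≢ ∘ Fin.↑ʳ-injective n _ _ ]′ ∘ avoids {d} {4F} (partners d a)
          ]′
        where
        ≢-self : ∀ e → ¬ a ↑ˡ n ≡ n ↑ʳ permute n e a
        ≢-self e eq = link-irrefl e 4F (subst (λ j → Link e 4F j (n ↑ʳ permute n e a)) eq (partners e a))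

        1<n+n : 1 ℕ.< n ℕ.+ n
        1<n+n = ℕ.+-mono-≤ 0<n 0<n
          where
          0<n : 0 ℕ.< n
          0<n = ℕ.≤-<-trans ℕ.z≤n (Fin.toℕ<n a)

        open Frame 1<n+n (P c) (P d) distinct nondegenerate
          (λ ij → same {0F} ij ij) (λ ij → same {2F} ij ij)

    -- Each code yields a table with one of `K ^ 5` label vectors at each of the `n + n` places.
    -- Were there fewer tables than codes, two different codes would share one; `same-partners`
    -- makes their matchings agree, against `permute-faithful`.
    contradicted : ¬ (K ^ 5) ^ (n ℕ.+ n) ℕ.< n !
    contradicted K^<n! = ¬¬-∀ (λ c → ¬¬-∀ λ i → ¬¬-∀ λ r → label-exists c i r) λ labels →
      let label : Fin (n !) → Fin (n ℕ.+ n) → Fin 5 → Fin K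
          label c i r = proj₁ (labels c i r)
          encode : Fin (n !) → Fin ((K ^ 5) ^ (n ℕ.+ n))
          encode c = funToFin λ i → funToFin (label c i)
          decode : ∀ c i r → finToFun {K} {5} (finToFun (encode c) i) r ≡ label c i r
          decode c i r = trans
            (cong (λ x → finToFun {K} {5} x r) (Fin.finToFun-funToFin (λ i → funToFin (label c i)) i))
            (Fin.finToFun-funToFin (label c i) r)
          (c , d , c<d , eq) = Fin.pigeonhole K^<n! encode
          same-labels : ∀ i r → label c i r ≡ label d i r
          same-labels i r = trans (sym (decode c i r))
            (trans (cong (λ x → finToFun {K} {5} (finToFun x i) r) eq) (decode d i r))
      in Fin.<⇒≢ c<d (permute-faithful n (same-partners λ {r} {i} lᶜ lᵈ →
           Label⇒homothetic (label c i r) (proj₂ (labels c i r) lᶜ)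
             (subst (λ l → Label l (P d i) (P d _)) (sym (same-labels i r)) (proj₂ (labels d i r) lᵈ))))

  -- Formulated for all graphs that contain the union, because regularising it adds vertices and
  -- edges; a drawing of the larger graph restricts to the components.
  slopeCount-large : ∀ k → (let K = suc k ℕ.* 2) → (K ^ 5) ^ (n ℕ.+ n) ℕ.< n ! →
    ∀ {H} → frames-with-matchings ↪ H → ∀ D t → HasSlopeCount H D t → k ℕ.< t
  slopeCount-large k K^<n! {H} G↪H D t (σ , _ , _ , slope) = ℕ.≰⇒> λ t≤k →
    FewSlopes.contradicted {t} (λ c i → pos (vertex (combine c i)))
      (λ {c} → place-injective c ∘ pos-distinct)
      (λ {c} {r} l w∈uv → Sum.map (place-injective c) (place-injective c)
        (edge-avoids (edge (link⇒~ {r = r} l)) w∈uv))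
      σ (λ {c} {r} l → slope (edge (link⇒~ {r = r} l)))
      k (ℕ.m≤n⇒m≤1+n t≤k) K^<n!
    where
    open _↪_ G↪H
    open GeometricDrawing D
    place-injective : ∀ c {i j} → vertex (combine c i) ≡ vertex (combine c j) → i ≡ j
    place-injective c eq = proj₂ (Fin.combine-injective c _ c _ (vertex-injective eq))

∣i∣<n⇒i<n : ∀ i {n} → ℤ.∣ i ∣ ℕ.< n → i < + n
∣i∣<n⇒i<n (+ m)    m<n = ℤ.+<+ m<n
∣i∣<n⇒i<n -[1+ m ] _   = ℤ.-<+

open FramesWithMatchings

theorem2 : (Δ : ℕ) → 5 ≤ Δ → (k : ℤ) →
    ∃ λ (G : Graph) → Regular Δ G ×
    ¬ ¬ (∃ λ (s : ℕ) → IsSlopeNumber G s × k < + s)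
theorem2 Δ 5≤Δ k =
  let K            = suc ℤ.∣ k ∣ ℕ.* 2
      L            = K ^ 5
      L≢0          = ℕ.m^n≢0 K 5
      -- `L` label vectors at each of `n + n` places make `L ^ (n + n) = (L * L) ^ n` tables, so the
      -- base to be dominated is `L * L`.
      (n , L²ⁿ<n!) = factorial-dominates (L ℕ.* L) {{ℕ.m*n≢0 L L {{L≢0}} {{L≢0}}}}
      Lⁿ⁺ⁿ<n!      = subst (ℕ._< n !) (trans (^-distribʳ-* L L n) (sym (ℕ.^-distribˡ-+-* L n n))) L²ⁿ<n!
      (H , H-regular , G↪H) = regularise Δ (frames-with-matchings n)
        (λ v → ℕ.≤-trans (degree≤5 n v) 5≤Δ) (λ v → ℕ.m≤m+n Δ _)
  in H , H-regular , λ ¬∃ → slopeNumber-exists H λ (s , (D , count) , minimal) →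
    ¬∃ (s , ((D , count) , minimal) , ∣i∣<n⇒i<n k (slopeCount-large n ℤ.∣ k ∣ Lⁿ⁺ⁿ<n! G↪H D s count))
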